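{- The Dominating Subtree problem admits a polynomial-time approximation algorithm with approximation ratio $O(\log n)$, where $n=|V|$ is the number of nodes of the input graph. That is, on every feasible instance the algorithm outputs a feasible solution whose size is at most $O(\log n)$ times the minimum size of a feasible solution.
   Context: Graphs are finite and undirected. The Dominating Subtree problem: the input is a graph $G=(V,E)$ and a spanning tree $T=(V,E_T)$ in $G$; the goal is to find a minimum-size edge set $F\subseteq E\setminus E_T$ such that $T_F$ is a dominating tree. Here, for $f\in E\setminus E_T$, $T_f$ denotes the path in the tree $T$ between the endnodes of $f$, and $T_F=\bigcup_{f\in F}T_f$ is the subgraph of $T$ formed by the tree edges covered by $F$ (its nodes are the endnodes of these edges). $T_F$ is a dominating tree if it is a tree (i.e. connected) and its node set is a dominating set in $G$, meaning that every node of $V$ outside $T_F$ has a neighbor in $G$ that belongs to $T_F$. -}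

module Defs where

open import Data.Bool.Base using (Bool; true; false)
open import Data.Fin.Base using (Fin; toℕ)
open import Data.Fin.Subset using (Subset; _∈_; _∉_; ∣_∣)
open import Data.List.Base as List using (List)
import Data.List.Membership.Propositional as ListMembership
open import Data.List.Relation.Unary.Unique.Propositional using (Unique)
open import Data.Nat.Base using (ℕ; zero; suc; _+_; _*_; _^_; _≤_)
open import Data.Product.Base using (Σ; ∃; ∃-syntax; _×_; _,_)
open import Data.Sum.Base using (_⊎_)
open import Data.Vec.Base as Vec using (Vec; []; _∷_; lookup; toList; zip)
open import Level using (0ℓ)
open import Relation.Binary.PropositionalEquality.Core using (_≡_)
open import Relation.Nullary.Negation.Core using (¬_)
open import Relation.Unary using (Pred; U)

-- Parallel edges and loops are allowed, so edges have names in Fin size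
-- and an edge set is a subset of Fin size, not a set of node pairs.

record Graph : Set where
  field
    order : ℕ
    size  : ℕ
    ends  : Vec (Fin order × Fin order) size

  Node Edge : Set
  Node = Fin order
  Edge = Fin size

  Joins : Edge → Node → Node → Set
  Joins e u v = (lookup ends e ≡ (u , v)) ⊎ (lookup ends e ≡ (v , u))

  data Walk (S : Pred Edge 0ℓ) (u : Node) : Node → Set where
    stop : Walk S u u
    step : ∀ {v w} (e : Edge) → S e → Joins e u v → Walk S v w → Walk S u w

  nodes : ∀ {S u v} → Walk S u v → List Node
  nodes {u = u} stop           = u List.∷ List.[]
  nodes {u = u} (step _ _ _ w) = u List.∷ nodes w

  edges : ∀ {S u v} → Walk S u v → List Edge
  edges stop           = List.[]
  edges (step e _ _ w) = e List.∷ edges w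

  IsPath : ∀ {S u v} → Walk S u v → Set
  IsPath w = Unique (nodes w)

  open ListMembership using () renaming (_∈_ to _∈ˡ_; _∉_ to _∉ˡ_)

  -- A cycle is a path closed up by an edge that is not on it; loops and
  -- pairs of parallel edges are cycles of lengths 1 and 2.

  Acyclic : Pred Edge 0ℓ → Set
  Acyclic S = ∀ {e u v} → S e → Joins e u v →
              ¬ (Σ (Walk S v u) λ p → IsPath p × e ∉ˡ edges p)

  -- N is intended to contain the end nodes of all edges in S.

  record IsTree (N : Pred Node 0ℓ) (S : Pred Edge 0ℓ) : Set where
    field
      nonempty  : ∃ N
      connected : ∀ {u v} → N u → N v → Walk S u v
      acyclic   : Acyclic S

  IsDominating : Pred Node 0ℓ → Set
  IsDominating N = ∀ v → ¬ N v → ∃[ u ] N u × ∃[ e ] Joins e v u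

  IsSpanningTree : Subset size → Set
  IsSpanningTree T = IsTree U (_∈ T)

  -- OnTreePath T f e: the edge e belongs to T_f.

  OnTreePath : Subset size → Edge → Pred Edge 0ℓ
  OnTreePath T f e = let (u , v) = lookup ends f in
    Σ (Walk (_∈ T) u v) λ p → IsPath p × e ∈ˡ edges p

  CoveredEdge : Subset size → Subset size → Pred Edge 0ℓ
  CoveredEdge T F e = ∃[ f ] f ∈ F × OnTreePath T f e

  CoveredNode : Subset size → Subset size → Pred Node 0ℓ
  CoveredNode T F u = ∃[ e ] CoveredEdge T F e × ∃[ v ] Joins e u v

record Instance : Set where
  field
    graph : Graph
  open Graph graph public
  field
    tree     : Subset size
    spanning : IsSpanningTree tree

  record Feasible (F : Subset size) : Set where
    field
      nonTree    : ∀ {f} → f ∈ F → f ∉ tree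
      isTree     : IsTree (CoveredNode tree F) (CoveredEdge tree F)
      dominating : IsDominating (CoveredNode tree F)

  IsMinimumSize : ℕ → Set
  IsMinimumSize k = (∃[ F ] Feasible F × ∣ F ∣ ≡ k) ×
                    (∀ F → Feasible F → k ≤ ∣ F ∣)

-- Model of computation: pure first-order LISP.  Data are binary trees; a
-- program is a recursive function definition that may call itself and
-- previously defined functions.

infixr 5 _∙_

data D : Set where
  nil : D
  _∙_ : D → D → D

∥_∥ : D → ℕ
∥ nil   ∥ = 1
∥ x ∙ y ∥ = suc (∥ x ∥ + ∥ y ∥)

-- Exp a n: expressions in n variables inside the body of an a-ary function.
-- A function of arity a is given by its body, in Exp a a.  The variables
-- bound in the last argument of `case` are the two subtrees of the scrutinee.

data Exp (a : ℕ) (n : ℕ) : Set where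
  var  : Fin n → Exp a n
  nil  : Exp a n
  cons : Exp a n → Exp a n → Exp a n
  case : Exp a n → Exp a n → Exp a (2 + n) → Exp a n
  self : Vec (Exp a n) a → Exp a n
  call : ∀ {k} → Exp k k → Vec (Exp a n) k → Exp a n

Program : Set
Program = Exp 1 1

-- b , ρ ⊢ e ⇓ v ∣ t: in the function with body b and under the environment
-- ρ, the expression e evaluates to v in t steps.  Every rule costs one step.
-- For a fixed program each step is a bounded number of pointer operations
-- (subtrees are shared, never copied), so the cost is polynomially related
-- to time on random access and Turing machines.

infix 4 _,_⊢_⇓_∣_ _,_⊢_⇓*_∣_

mutual
  data _,_⊢_⇓_∣_ {a n : ℕ} (b : Exp a a) (ρ : Vec D n) :
                 Exp a n → D → ℕ → Set where

    var      : ∀ x → b , ρ ⊢ var x ⇓ lookup ρ x ∣ 1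

    nil      : b , ρ ⊢ nil ⇓ nil ∣ 1

    cons     : ∀ {e₁ e₂ v₁ v₂ s t} →
               b , ρ ⊢ e₁ ⇓ v₁ ∣ s →
               b , ρ ⊢ e₂ ⇓ v₂ ∣ t →
               b , ρ ⊢ cons e₁ e₂ ⇓ v₁ ∙ v₂ ∣ suc (s + t)

    caseNil  : ∀ {e e₁ e₂ v s t} →
               b , ρ ⊢ e ⇓ nil ∣ s →
               b , ρ ⊢ e₁ ⇓ v ∣ t →
               b , ρ ⊢ case e e₁ e₂ ⇓ v ∣ suc (s + t)

    caseCons : ∀ {e e₁ e₂ x y v s t} →
               b , ρ ⊢ e ⇓ x ∙ y ∣ s →
               b , x ∷ y ∷ ρ ⊢ e₂ ⇓ v ∣ t →
               b , ρ ⊢ case e e₁ e₂ ⇓ v ∣ suc (s + t)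

    self     : ∀ {es vs v s t} →
               b , ρ ⊢ es ⇓* vs ∣ s →
               b , vs ⊢ b ⇓ v ∣ t →
               b , ρ ⊢ self es ⇓ v ∣ suc (s + t)

    call     : ∀ {k} {g : Exp k k} {es vs v s t} →
               b , ρ ⊢ es ⇓* vs ∣ s →
               g , vs ⊢ g ⇓ v ∣ t →
               b , ρ ⊢ call g es ⇓ v ∣ suc (s + t)

  data _,_⊢_⇓*_∣_ {a n : ℕ} (b : Exp a a) (ρ : Vec D n) :
                  ∀ {k} → Vec (Exp a n) k → Vec D k → ℕ → Set where

    []  : b , ρ ⊢ [] ⇓* [] ∣ 0

    _∷_ : ∀ {k e v s t} {es : Vec (Exp a n) k} {vs} →
          b , ρ ⊢ e ⇓ v ∣ s →
          b , ρ ⊢ es ⇓* vs ∣ t →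
          b , ρ ⊢ e ∷ es ⇓* v ∷ vs ∣ s + t

Runs : Program → D → D → ℕ → Set
Runs p x y t = p , x ∷ [] ⊢ p ⇓ y ∣ t

Outputs : Program → D → D → Set
Outputs p x y = ∃[ t ] Runs p x y t

-- The bound c * s ^ d covers all polynomials since ∥ x ∥ is never zero.

PolynomialTimeOn : {A : Set} → (A → D) → Program → Set
PolynomialTimeOn encode p =
  ∃[ c ] ∃[ d ] ∀ x → ∃[ y ] ∃[ t ]
    Runs p (encode x) y t × t ≤ c * ∥ encode x ∥ ^ d

-- Numbers are coded in unary.  Since the graph has a spanning tree, n ≤ m + 1
-- and the code is of size polynomial in that of any other usual coding.

encodeℕ : ℕ → D
encodeℕ zero    = nil
encodeℕ (suc n) = nil ∙ encodeℕ n

encodeBool : Bool → D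
encodeBool false = nil
encodeBool true  = nil ∙ nil

encodeList : {A : Set} → (A → D) → List A → D
encodeList f = List.foldr (λ x d → f x ∙ d) nil

encodeSubset : ∀ {m} → Subset m → D
encodeSubset F = encodeList encodeBool (toList F)

-- The number of nodes and the list of edges ((u , v) , is it in the tree?).

encodeInstance : Instance → D
encodeInstance I = encodeℕ order ∙ encodeList encodeEdge (toList (zip ends tree))
  where
  open Instance I
  encodeEdge : (Node × Node) × Bool → D
  encodeEdge ((u , v) , b) =
    (encodeℕ (toℕ u) ∙ encodeℕ (toℕ v)) ∙ encodeBool b

{-# OPTIONS --safe #-}
module Submission where

-- Call the edges outside the tree links. First choose links greedily so that the nodes
-- of their tree paths dominate the graph: since a solution of size k dominates, some
-- link always deals with a k-th of the remaining nodes, and k (1 + log n) links suffice.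
-- Then grow a connected set A of links, starting from one chosen link. While some chosen
-- link is missing from A, there are three links that join A to such a link by a chain of
-- intersecting tree paths: walk in the tree of a solution from a node dominated by A to a
-- node dominated by a missing link; somewhere on the way the two kinds of nodes are equal
-- or adjacent, and by lemma `attach` one link suffices to join a path to a node of the
-- solution that it dominates. So connecting costs a factor of five only.
--
-- An edge e lies on the tree path between u and v if and only if removing e from the
-- tree separates u from v; this is how the program computes the paths.

-- The obstacle in connecting is that the edge by which a path dominates a node may be a tree edge,
-- which no solution may contain. Then `attach` finds a link that covers this edge: one of the
-- solution, or one given by the domination of a further node. The ratio is 10 log n: five for
-- connecting, and two because `1 + log n ≤ 2 * log n` for `n ≥ 2`. The program never sees a
-- solution; a feasible `F` enters the analysis only. The second obstacle is the model of
-- computation, since correctness and running time must concern the same program. So the algorithm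
-- is written from the start with folds over lists, iteration counts being the lengths of fuel
-- lists, and with decision procedures whose `does` is a Boolean expression. Programs for such
-- functions are then assembled by combinators on `FP`, which carry time and size bounds along; only
-- a few primitives are checked against the evaluation rules.

open import Algebra.Properties.CommutativeSemigroup using (x∙yz≈y∙xz)
open import Data.Bool.Base using (Bool; true; false; not; _∧_; _∨_; if_then_else_)
open import Data.Fin.Base using (Fin; zero; suc; toℕ; opposite)
open import Data.Fin.Properties using (_≟_; injective⇒≤; toℕ-injective; toℕ-fromℕ; opposite-involutive; opposite-suc)
open import Data.Fin.Subset using (Subset; _∈_; _∉_; ∣_∣; ⁅_⁆; _∪_; ⊥; inside; outside)
open import Data.Fin.Subset.Properties using (_∈?_; p⊆q⇒∣p∣≤∣q∣; ∣⊥∣≡0; x∈⁅x⁆; x∈p∪q⁺; ∪-identityˡ)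
open import Data.List.Base as List using (List; []; _∷_; _++_; foldr; length; filter; null; map; allFin; replicate)
import Data.List.Membership.DecPropositional as DecMembership
open import Data.List.Membership.Propositional using (find; lose) renaming (_∈_ to _∈ˡ_; _∉_ to _∉ˡ_)
open import Data.List.Membership.Propositional.Properties using (∈-filter⁺; ∈-filter⁻; ∈-allFin; ∈-tabulate⁺; ∈-lookup; ∈-map⁺; ∈-map⁻)
open import Data.List.Properties using (length-map; length-++; length-filter; length-tabulate; filter-none; tabulate-cong)
open import Data.List.Relation.Unary.All as All using (All; []; _∷_)
open import Data.List.Relation.Unary.All.Properties using (¬Any⇒All¬)
open import Data.List.Relation.Unary.AllPairs using ([]; _∷_)
open import Data.List.Relation.Unary.Any using (Any; here; there; any?; satisfied)
open import Data.List.Relation.Unary.Unique.Propositional using (Unique)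
open import Data.Nat.Base
open import Data.Nat.Induction using (<-rec)
open import Data.Nat.Logarithm using (⌊log₂_⌋; ⌊log₂⌋-mono-≤; ⌊log₂⌊n/2⌋⌋≡⌊log₂n⌋∸1; ⌊log₂[2^n]⌋≡n)
open import Data.Nat.Properties hiding (_≟_)
open import Data.Nat.Tactic.RingSolver using (solve-∀)
open import Data.Product.Base using (Σ; ∃; ∃-syntax; _×_; _,_; proj₁; proj₂)
open import Data.Sum.Base using (_⊎_; inj₁; inj₂; swap)
open import Data.Unit.Base using (⊤; tt)
open import Data.Vec.Base as Vec using (Vec; []; _∷_; here; there; lookup; toList; zip)
open import Data.Vec.Properties using (lookup∘tabulate; lookup⇒[]=; []=⇒lookup; lookup-zip; toList-replicate)
open import Function.Base using (_∘_; id)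
open import Function.Bundles using (mk⇔)
open import Level using (0ℓ)
open import Relation.Binary.Definitions using (DecidableEquality)
open import Relation.Binary.PropositionalEquality
open import Relation.Nullary using (Dec; yes; no; does; ¬_; contradiction)
open import Relation.Nullary.Decidable using (map′; ¬?; _×-dec_; _⊎-dec_; does-⇔; dec-true)
open import Relation.Unary using (Pred; Decidable)
open import Defs

-- Trees and walks

lookup-injective : ∀ {A : Set} {xs : List A} → Unique xs → ∀ {i j} →
                   List.lookup xs i ≡ List.lookup xs j → i ≡ j
lookup-injective (x∉ ∷ u) {zero}  {zero}  eq = refl
lookup-injective (x∉ ∷ u) {zero}  {suc j} eq = contradiction eq (All.lookup x∉ (∈-lookup j))
lookup-injective (x∉ ∷ u) {suc i} {zero}  eq = contradiction (sym eq) (All.lookup x∉ (∈-lookup i))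
lookup-injective (x∉ ∷ u) {suc i} {suc j} eq = cong suc (lookup-injective u eq)

unique⇒length≤ : ∀ {n} {xs : List (Fin n)} → Unique xs → length xs ≤ n
unique⇒length≤ u = injective⇒≤ (lookup-injective u)

module Walks (G : Graph) where

  open Graph G

  private
    variable
      S S′ : Pred Edge 0ℓ
      e e′ : Edge
      u v w x y z : Node

  _≟ᵉ_ : (e f : Edge) → Dec (e ≡ f)
  _≟ᵉ_ = _≟_

  open DecMembership {A = Node} _≟_ public using () renaming (_∈?_ to _∈ⁿ?_)
  open DecMembership {A = Edge} _≟_ public using () renaming (_∈?_ to _∈ᵉ?_)

  infixl 8 _∖_

  _∖_ : Pred Edge 0ℓ → Edge → Pred Edge 0ℓ
  (S ∖ e) e′ = S e′ × e′ ≢ e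

  joins-sym : Joins e u v → Joins e v u
  joins-sym = swap

  joins-ends : Joins e u v → Joins e x y → (x ≡ u × y ≡ v) ⊎ (x ≡ v × y ≡ u)
  joins-ends (inj₁ p) (inj₁ q) with refl ← trans (sym p) q = inj₁ (refl , refl)
  joins-ends (inj₁ p) (inj₂ q) with refl ← trans (sym p) q = inj₂ (refl , refl)
  joins-ends (inj₂ p) (inj₁ q) with refl ← trans (sym p) q = inj₂ (refl , refl)
  joins-ends (inj₂ p) (inj₂ q) with refl ← trans (sym p) q = inj₁ (refl , refl)

  joins-other : Joins e u v → Joins e u w → v ≡ w
  joins-other j k with joins-ends j k
  ... | inj₁ (_ , refl)    = refl
  ... | inj₂ (refl , refl) = refl

  infixr 5 _++ʷ_

  _++ʷ_ : Walk S u v → Walk S v w → Walk S u w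
  stop         ++ʷ q = q
  step e s j p ++ʷ q = step e s j (p ++ʷ q)

  reverseʷ : Walk S u v → Walk S v u
  reverseʷ stop           = stop
  reverseʷ (step e s j p) = reverseʷ p ++ʷ step e s (joins-sym j) stop

  mapʷ : (∀ {e} → S e → S′ e) → Walk S u v → Walk S′ u v
  mapʷ f stop           = stop
  mapʷ f (step e s j p) = step e (f s) j (mapʷ f p)

  nodes-mapʷ : (f : ∀ {e} → S e → S′ e) (p : Walk S u v) → nodes (mapʷ f p) ≡ nodes p
  nodes-mapʷ f stop                   = refl
  nodes-mapʷ {u = u} f (step e s j p) = cong (u ∷_) (nodes-mapʷ f p)

  edges-mapʷ : (f : ∀ {e} → S e → S′ e) (p : Walk S u v) → edges (mapʷ f p) ≡ edges p
  edges-mapʷ f stop           = refl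
  edges-mapʷ f (step e s j p) = cong (e ∷_) (edges-mapʷ f p)

  acyclic-⊆ : (∀ {e} → S e → S′ e) → Acyclic S′ → Acyclic S
  acyclic-⊆ f acyclic s j (p , unique , e∉) = acyclic (f s) j
    (mapʷ f p , subst Unique (sym (nodes-mapʷ f p)) unique , subst (_ ∉ˡ_) (sym (edges-mapʷ f p)) e∉)

  start∈nodes : (p : Walk S u v) → u ∈ˡ nodes p
  start∈nodes stop           = here refl
  start∈nodes (step _ _ _ _) = here refl

  length-nodes : (p : Walk S u v) → length (nodes p) ≡ suc (length (edges p))
  length-nodes stop           = refl
  length-nodes (step _ _ _ p) = cong suc (length-nodes p)

  edges⊆ : (p : Walk S u v) → e ∈ˡ edges p → S e
  edges⊆ (step _ s _ _) (here refl) = s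
  edges⊆ (step _ _ _ p) (there e∈)  = edges⊆ p e∈

  joins∈nodes : (p : Walk S u v) → e ∈ˡ edges p → Joins e x y → x ∈ˡ nodes p
  joins∈nodes (step _ _ j p) (here refl) k with joins-ends j k
  ... | inj₁ (refl , _) = here refl
  ... | inj₂ (refl , _) = there (start∈nodes p)
  joins∈nodes (step _ _ _ p) (there e∈) k = there (joins∈nodes p e∈ k)

  -- The edge set is that of `p` instead of `S`, so that the prefix of a tree path of a link is seen
  -- to consist of covered edges; see `linkWalk`.
  prefix : (p : Walk S u v) → x ∈ˡ nodes p → Walk (_∈ˡ edges p) u x
  prefix stop           (here refl) = stop
  prefix (step e s j p) (here refl) = stop
  prefix (step e s j p) (there x∈)  = step e (here refl) j (mapʷ there (prefix p x∈))

  suffix : (p : Walk S u v) → IsPath p → x ∈ˡ nodes p → Σ (Walk S x v) IsPath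
  suffix stop           unique       (here refl) = stop , unique
  suffix (step e s j p) unique       (here refl) = step e s j p , unique
  suffix (step e s j p) (_ ∷ unique) (there x∈)  = suffix p unique x∈

  toPath : Walk S u v → Σ (Walk S u v) IsPath
  toPath stop = stop , [] ∷ []
  toPath {u = u} (step e s j p) with toPath p
  ... | q , unique with u ∈ⁿ? nodes q
  ...   | yes u∈ = suffix q unique u∈
  ...   | no  u∉ = step e s j q , ¬Any⇒All¬ _ u∉ ∷ unique

  first-edge : u ≢ v → (p : Walk S u v) → ∃[ e ] e ∈ˡ edges p × ∃[ w ] Joins e u w
  first-edge u≢v stop           = contradiction refl u≢v
  first-edge u≢v (step e s j p) = e , here refl , _ , j

  avoid : (p : Walk S u v) → e ∉ˡ edges p → Walk (S ∖ e) u v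
  avoid stop           e∉ = stop
  avoid (step e s j p) e∉ = step e (s , λ eq → e∉ (here (sym eq))) j (avoid p (e∉ ∘ there))

  -- A path runs through each of its edges once.
  split : (p : Walk S u v) → IsPath p → e ∈ˡ edges p →
          ∃[ x ] ∃[ y ] Joins e x y × Walk (S ∖ e) u x × Walk (S ∖ e) y v
  split (step e s j p) (u∉ ∷ unique) (here refl) =
    _ , _ , j , stop , avoid p λ e∈ → All.lookup u∉ (joins∈nodes p e∈ j) refl
  split {u = u} {e = e} (step e′ s j p) (u∉ ∷ unique) (there e∈)
    with split p unique e∈ | e′ ≟ᵉ e
  ... | x , y , k , q , r | no  e′≢e = x , y , k , step e′ (s , e′≢e) j q , r
  ... | x , y , k , q , r | yes refl = contradiction refl (All.lookup u∉ (joins∈nodes p e∈ j))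

  ∖-avoids : (p : Walk (S ∖ e) u v) → e ∉ˡ edges (mapʷ {S′ = S} proj₁ p)
  ∖-avoids (step e (_ , e≢e) j p) (here refl) = e≢e refl
  ∖-avoids (step e s j p)         (there e∈)  = ∖-avoids p e∈

  -- A walk that avoids `e` shortens to a path that avoids `e`, and `e` closes it to a cycle. All
  -- arguments about removing an edge from the tree use acyclicity in this form.
  no-bypass : Acyclic S → S e → Joins e u v → ¬ Walk (S ∖ e) u v
  no-bypass acyclic s j p with toPath (reverseʷ p)
  ... | q , unique = acyclic s j
    (mapʷ proj₁ q , subst Unique (sym (nodes-mapʷ proj₁ q)) unique , ∖-avoids q)

-- Tree paths, domination and intersection, with their decision procedures.

module Algorithm (I : Instance) where

  open Instance I
  open Walks graph public

  private
    variable
      e e′ f g : Edge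
      u v w x y z : Node

  src tgt : Edge → Node
  src e = proj₁ (lookup ends e)
  tgt e = proj₂ (lookup ends e)

  joins-src-tgt : ∀ e → Joins e (src e) (tgt e)
  joins-src-tgt e = inj₁ refl

  -- The order is descending because the preprocessing program numbers list entries from the end,
  -- and the codes of nodes are prescribed by the input. Edges have no names in the input and are
  -- only compared, so their list stays ascending and their codes count from the end instead.
  allNodes : List Node
  allNodes = List.tabulate opposite

  allEdges : List Edge
  allEdges = allFin size

  ∈-allNodes : ∀ x → x ∈ˡ allNodes
  ∈-allNodes x = subst (_∈ˡ allNodes) (opposite-involutive x) (∈-tabulate⁺ (opposite x))

  length-allNodes : length allNodes ≡ order
  length-allNodes = length-tabulate opposite

  ∃ᵉ? : {P : Pred Edge 0ℓ} → (∀ e → Dec (P e)) → Dec (∃ P)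
  ∃ᵉ? P? = map′ satisfied (λ (e , p) → lose (∈-allFin e) p) (any? P? allEdges)

  ∃ⁿ? : {P : Pred Node 0ℓ} → (∀ x → Dec (P x)) → Dec (∃ P)
  ∃ⁿ? P? = map′ satisfied (λ (x , p) → lose (∈-allNodes x) p) (any? P? allNodes)

  opaque
    -- As `map′` leaves `does` unchanged, unfolding turns `does` of this decision into the very
    -- Boolean expression that `joins?ᶠ` evaluates; elsewhere it stays opaque. The decisions below
    -- follow the same pattern.
    joins? : ∀ e u v → Dec (Joins e u v)
    joins? e u v = map′
      (λ { (inj₁ (refl , refl)) → inj₁ refl ; (inj₂ (refl , refl)) → inj₂ refl })
      (λ { (inj₁ eq) → inj₁ (cong proj₁ eq , cong proj₂ eq)
         ; (inj₂ eq) → inj₂ (cong proj₁ eq , cong proj₂ eq) })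
      ((src e ≟ u ×-dec tgt e ≟ v) ⊎-dec (src e ≟ v ×-dec tgt e ≟ u))

  Tree : Pred Edge 0ℓ
  Tree = _∈ tree

  adjacent? : ∀ e (xs : List Node) y →
              Dec (Any (λ e′ → (Tree ∖ e) e′ × Any (Joins e′ y) xs) allEdges)
  adjacent? e xs y =
    any? (λ e′ → (e′ ∈? tree ×-dec ¬? (e′ ≟ e)) ×-dec any? (joins? e′ y) xs) allEdges

  -- Filtering `allNodes`, rather than appending the new nodes, keeps the list no longer than
  -- `allNodes`; the size bound of `reachᶠ` rests on this.
  expand : Edge → List Node → List Node
  expand e xs = filter (λ y → y ∈ⁿ? xs ⊎-dec adjacent? e xs y) allNodes

  -- The nodes from which z is reached in at most length fuel steps of Tree ∖ e.
  reach : Edge → Node → List Node → List Node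
  reach e z fuel = foldr (λ _ xs → expand e xs) (filter (_≟ z) allNodes) fuel

  reach-sound : ∀ fuel → x ∈ˡ reach e z fuel → Walk (Tree ∖ e) x z
  reach-sound {z = z} [] x∈ with refl ← proj₂ (∈-filter⁻ (_≟ z) {xs = allNodes} x∈) = stop
  reach-sound {e = e} {z = z} (_ ∷ fuel) x∈
    with proj₂ (∈-filter⁻ (λ y → y ∈ⁿ? reach e z fuel ⊎-dec adjacent? e (reach e z fuel) y)
                          {xs = allNodes} x∈)
  ... | inj₁ x∈′ = reach-sound fuel x∈′
  ... | inj₂ any with satisfied any
  ...   | e′ , s , any′ with find any′
  ...     | y , y∈ , j = step e′ s j (reach-sound fuel y∈)

  reach-complete : ∀ fuel (p : Walk (Tree ∖ e) x z) → length (edges p) ≤ length fuel →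
                   x ∈ˡ reach e z fuel
  reach-complete {z = z} [] stop le = ∈-filter⁺ (_≟ z) (∈-allNodes z) refl
  reach-complete {e = e} {z = z} (_ ∷ fuel) stop le =
    ∈-filter⁺ (λ y → y ∈ⁿ? reach e z fuel ⊎-dec adjacent? e (reach e z fuel) y)
              (∈-allNodes z) (inj₁ (reach-complete fuel stop z≤n))
  reach-complete {e = e} {x = x} {z = z} (_ ∷ fuel) (step e′ s j p) (s≤s le) =
    ∈-filter⁺ (λ y → y ∈ⁿ? reach e z fuel ⊎-dec adjacent? e (reach e z fuel) y)
      (∈-allNodes x)
      (inj₂ (lose (∈-allFin e′) (s , lose (reach-complete fuel p le) j)))

  opaque
    walk? : ∀ e x y → Dec (Walk (Tree ∖ e) x y)
    walk? e x y = map′ (reach-sound allNodes) complete (x ∈ⁿ? reach e y allNodes)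
      where
      complete : Walk (Tree ∖ e) x y → x ∈ˡ reach e y allNodes
      complete p with toPath p
      -- A path has at most `order` nodes, hence fewer edges than the fuel has entries.
      ... | q , unique = reach-complete allNodes q (≤-trans (n≤1+n _)
        (≤-trans (≤-reflexive (sym (length-nodes q)))
                 (≤-trans (unique⇒length≤ unique) (≤-reflexive (sym length-allNodes)))))

  -- The edge e lies on the tree path between u and v.
  Between : Edge → Node → Node → Set
  Between e u v = Tree e × ¬ Walk (Tree ∖ e) u v

  opaque
    between? : ∀ e u v → Dec (Between e u v)
    between? e u v = e ∈? tree ×-dec ¬? (walk? e u v)

  between-sym : Between e u v → Between e v u
  between-sym (t , ¬p) = t , ¬p ∘ reverseʷ

  Covers : Edge → Edge → Set
  Covers f e = Between e (src f) (tgt f)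

  covers? : ∀ f e → Dec (Covers f e)
  covers? f e = between? e (src f) (tgt f)

  Visits : Edge → Node → Set
  Visits f x = ∃[ e ] Covers f e × (src e ≡ x ⊎ tgt e ≡ x)

  opaque
    visits? : ∀ f x → Dec (Visits f x)
    visits? f x = ∃ᵉ? λ e → covers? f e ×-dec (src e ≟ x ⊎-dec tgt e ≟ x)

  Near : Node → Node → Set
  Near x y = x ≡ y ⊎ (∃[ e ] Joins e x y)

  opaque
    near? : ∀ x y → Dec (Near x y)
    near? x y = x ≟ y ⊎-dec ∃ᵉ? λ e → joins? e x y

  Dominates : Edge → Node → Set
  Dominates f x = ∃[ y ] Visits f y × Near x y

  opaque
    dominates? : ∀ f x → Dec (Dominates f x)
    dominates? f x = ∃ⁿ? λ y → visits? f y ×-dec near? x y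

  Meets : Edge → Edge → Set
  Meets f g = ∃[ x ] Visits f x × Visits g x

  opaque
    meets? : ∀ f g → Dec (Meets f g)
    meets? f g = ∃ⁿ? λ x → visits? f x ×-dec visits? g x

  tree-acyclic : Acyclic Tree
  tree-acyclic = IsTree.acyclic spanning

  treePath : ∀ u v → Σ (Walk Tree u v) IsPath
  treePath u v = toPath (IsTree.connected spanning _ _)

  between⇒∈path : (p : Walk Tree u v) → Between e u v → e ∈ˡ edges p
  between⇒∈path {e = e} p (t , ¬q) with e ∈ᵉ? edges p
  ... | yes e∈ = e∈
  ... | no  e∉ = contradiction (avoid p e∉) ¬q

  -- Cutting the path at `e` leaves two pieces that avoid `e`. A walk from `u` to `v` avoiding `e`
  -- would link them to a bypass of `e`.
  ∈path⇒between : (p : Walk Tree u v) → IsPath p → e ∈ˡ edges p → Between e u v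
  ∈path⇒between p unique e∈ with split p unique e∈
  ... | x , y , j , q , r = edges⊆ p e∈ , λ s →
    no-bypass tree-acyclic (edges⊆ p e∈) j (reverseʷ q ++ʷ s ++ʷ reverseʷ r)

  covers⇒onTreePath : Covers f e → OnTreePath tree f e
  covers⇒onTreePath {f} c with treePath (src f) (tgt f)
  ... | p , unique = p , unique , between⇒∈path p c

  onTreePath⇒covers : OnTreePath tree f e → Covers f e
  onTreePath⇒covers (p , unique , e∈) = ∈path⇒between p unique e∈

  visits : Covers f e → Joins e x y → Visits f x
  visits c (inj₁ eq) = _ , c , inj₁ (cong proj₁ eq)
  visits c (inj₂ eq) = _ , c , inj₂ (cong proj₂ eq)

  visits⇒joins : Visits f x → ∃[ e ] Covers f e × ∃[ y ] Joins e x y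
  visits⇒joins (e , c , inj₁ refl) = e , c , _ , inj₁ refl
  visits⇒joins (e , c , inj₂ refl) = e , c , _ , inj₂ refl

  between-joins : Joins f u v → Between e u v → Covers f e
  between-joins (inj₁ eq) b = subst (λ (x , y) → Between _ x y) (sym eq) b
  between-joins (inj₂ eq) b = subst (λ (x , y) → Between _ x y) (sym eq) (between-sym b)

  -- A loop covers no tree edge; distinct ends guarantee that the tree path has a first edge.
  visits-end : Joins f u v → u ≢ v → Visits f u
  visits-end {u = u} {v = v} j u≢v with treePath u v
  ... | p , unique with first-edge u≢v p
  ...   | e , e∈ , w , k = visits (between-joins j (∈path⇒between p unique e∈)) k

  linkWalk : Visits f x → Visits f y → Walk (Covers f) x y
  linkWalk {f} vx vy = reverseʷ (fromSrc vx) ++ʷ fromSrc vy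
    where
    p : Walk Tree (src f) (tgt f)
    p = proj₁ (treePath (src f) (tgt f))
    fromSrc : Visits f z → Walk (Covers f) (src f) z
    fromSrc vz with visits⇒joins vz
    ... | e , c , _ , j = mapʷ (∈path⇒between p (proj₂ (treePath (src f) (tgt f))))
                               (prefix p (joins∈nodes p (between⇒∈path p c) j))

  near-sym : Near x y → Near y x
  near-sym (inj₁ eq)      = inj₁ (sym eq)
  near-sym (inj₂ (e , j)) = inj₂ (e , joins-sym j)

  meets-sym : Meets f g → Meets g f
  meets-sym (x , v , w) = x , w , v

  coveredNode⇒visits : ∀ {F} → CoveredNode tree F x → ∃[ f ] f ∈ F × Visits f x
  coveredNode⇒visits (e , (f , f∈ , p) , _ , j) = f , f∈ , visits (onTreePath⇒covers p) j

  visits⇒coveredNode : ∀ {F} → f ∈ F → Visits f x → CoveredNode tree F x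
  visits⇒coveredNode f∈ v with visits⇒joins v
  ... | e , c , y , j = e , (_ , f∈ , covers⇒onTreePath c) , y , j

  DominatedBy : Pred Edge 0ℓ → Pred Node 0ℓ
  DominatedBy P x = ∃[ f ] P f × Dominates f x

  -- The links may coincide. In the construction `f₁` and `f₃` come from `attach`, while `f₂` is a
  -- link of the solution or repeats `f₁`.
  record Chain (P Q : Pred Edge 0ℓ) : Set where
    constructor chain
    field
      {a f₁ f₂ f₃ b} : Edge
      a∈   : P a
      b∈   : Q b
      link₁ : f₁ ∉ tree
      link₂ : f₂ ∉ tree
      link₃ : f₃ ∉ tree
      meets₁ : Meets a f₁
      meets₂ : Meets f₁ f₂
      meets₃ : Meets f₂ f₃
      meets₄ : Meets f₃ b

  -- Links and chains provided by a feasible solution.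

  module Solution {F : Subset size} (feasible : Feasible F) where

    open Feasible feasible

    Spanned : Pred Node 0ℓ
    Spanned x = ∃[ f ] f ∈ F × Visits f x

    spanned? : ∀ x → Dec (Spanned x)
    spanned? x = ∃ᵉ? λ f → f ∈? F ×-dec visits? f x

    near-spanned : ∀ x → ∃[ y ] Spanned y × Near x y
    near-spanned x with spanned? x
    ... | yes s = x , s , inj₁ refl
    ... | no ¬s with dominating x (¬s ∘ coveredNode⇒visits)
    ...   | y , c , e , j = y , coveredNode⇒visits c , inj₂ (e , j)

    dominated : ∀ x → DominatedBy (_∈ F) x
    dominated x with near-spanned x
    ... | y , (f , f∈ , v) , n = f , f∈ , y , v , n

    spanWalk : Spanned x → Spanned y → Walk (CoveredEdge tree F) x y
    spanWalk (f , f∈ , v) (g , g∈ , w) =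
      IsTree.connected isTree (visits⇒coveredNode f∈ v) (visits⇒coveredNode g∈ w)

    -- The solution connects its nodes by covered edges only. Together with `no-bypass` this forces
    -- a tree edge between two of its nodes to be covered.
    spanWalk-avoids : (∀ {f} → f ∈ F → ¬ Covers f e) → Spanned x → Spanned y → Walk (Tree ∖ e) x y
    spanWalk-avoids ¬c sx sy = mapʷ
      (λ (f , f∈ , p) → proj₁ (onTreePath⇒covers p) , λ { refl → ¬c f∈ (onTreePath⇒covers p) })
      (spanWalk sx sy)

    -- If `f` does not itself visit `y`, a link is needed whose tree path contains both `x` and `y`.
    -- The edge `e` between them serves if it is a link. If it is a tree edge, a link covering `e`
    -- is wanted: the solution has one if `x` is spanned as well, since otherwise its connectedness
    -- would bypass `e`.
    attach : f ∉ tree → Visits f x → Spanned y → Near y x → ∃[ g ] g ∉ tree × Visits g y × Meets f g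
    attach {f} {x} {y} f∉ vx sy (inj₁ refl) = f , f∉ , vx , x , vx , vx
    attach {f} {x} {y} f∉ vx sy (inj₂ (e , j)) with visits? f y | e ∈? tree | spanned? x
    ... | yes vy | _ | _ = f , f∉ , vy , x , vx , vx
    ... | no ¬vy | no e∉ | _ = e , e∉ , visits-end j y≢x , x , vx , visits-end (joins-sym j) (y≢x ∘ sym)
      where
      y≢x : y ≢ x
      y≢x refl = ¬vy vx
    ... | no ¬vy | yes e∈ | yes sx with ∃ᵉ? (λ g → g ∈? F ×-dec covers? g e)
    ...   | yes (g , g∈ , c) = g , nonTree g∈ , visits c j , x , vx , visits c (joins-sym j)
    ...   | no ¬c = contradiction (spanWalk-avoids (λ g∈ c → ¬c (_ , g∈ , c)) sy sx)
                                  (no-bypass tree-acyclic e∈ j)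
    attach {f} {x} {y} f∉ vx sy (inj₂ (e , j)) | no ¬vy | yes e∈ | no ¬sx with visits⇒joins vx
    -- The other end z of a tree edge of f at x is not spanned either, so it has a
    -- neighbour in the solution, and the edge to it closes a cycle through e.
    ... | e′ , c′ , z , j′ with near-spanned z
    ...   | w , sw , n = continue n
      where
      z≢y : z ≢ y
      z≢y refl = ¬vy (visits c′ (joins-sym j′))
      z≢x : z ≢ x
      z≢x refl = no-bypass tree-acyclic (proj₁ c′) j′ stop
      x→z : Walk (Tree ∖ e) x z
      x→z = step e′ (proj₁ c′ , λ { refl → z≢y (joins-other j′ (joins-sym j)) }) j′ stop
      w→y : Walk (Tree ∖ e) w y
      w→y = spanWalk-avoids (λ g∈ c → ¬sx (_ , g∈ , visits c (joins-sym j))) sw sy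
      separated : ¬ Walk (Tree ∖ e) z w
      separated q = no-bypass tree-acyclic e∈ (joins-sym j) (x→z ++ʷ q ++ʷ w→y)
      continue : Near z w → ∃[ g ] g ∉ tree × Visits g y × Meets f g
      continue (inj₁ refl) = contradiction stop separated
      continue (inj₂ (e″ , j″)) with e″ ∈? tree
      -- Removing `e` separates the ends `z` and `w` of `e″`, so `e″` covers `e` and visits both `y`
      -- and `x`. A tree edge `e″` would instead be a walk from `z` to `w` that survives the
      -- removal.
      ... | no e″∉ = e″ , e″∉ , visits c j , x , vx , visits c (joins-sym j)
        where
        c : Covers e″ e
        c = between-joins j″ (e∈ , separated)
      ... | yes e″∈ = contradiction (step e″ (e″∈ , e″≢e) j″ stop) separated
        where
        e″≢e : e″ ≢ e
        e″≢e refl with joins-ends j j″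
        ... | inj₁ (z≡y , _) = z≢y z≡y
        ... | inj₂ (z≡x , _) = z≢x z≡x

    module _ {P Q : Pred Edge 0ℓ} (P-links : ∀ {f} → P f → f ∉ tree) (Q-links : ∀ {f} → Q f → f ∉ tree)
             (all-dominated : ∀ x → DominatedBy P x ⊎ DominatedBy Q x) where

      -- The current node stays dominated by `P` while the last one is dominated by `Q`. So either
      -- the walk reaches a node dominated by both, or it has an edge leading from a node dominated
      -- by `P` to one dominated by `Q`.
      crossing : Walk (CoveredEdge tree F) x y → Spanned x → Spanned y →
                 DominatedBy P x → DominatedBy Q y → Chain P Q
      crossing stop sx sy (a , a∈ , u , va , na) (b , b∈ , w , vb , nb)
        with attach (P-links a∈) va sx na | attach (Q-links b∈) vb sx nb
      ... | g , g∉ , vg , m | h , h∉ , vh , m′ =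
        -- Both attached links visit the common node, so two links suffice and the first is
        -- repeated.
        chain a∈ b∈ g∉ g∉ h∉ m (_ , vg , vg) (_ , vg , vh) (meets-sym m′)
      crossing (step e (f , f∈ , p) j q) sx sy dx dy
        with all-dominated _
      ... | inj₁ d = crossing q (f , f∈ , visits (onTreePath⇒covers p) (joins-sym j)) sy d dy
      crossing (step e (f , f∈ , p) j q) sx sy (a , a∈ , u , va , na) dy
          | inj₂ (b , b∈ , w , vb , nb)
        with attach (P-links a∈) va sx na
           | attach (Q-links b∈) vb (f , f∈ , visits (onTreePath⇒covers p) (joins-sym j)) nb
      ... | g , g∉ , vg , m | h , h∉ , vh , m′ =
        -- The solution's link `f` covers the crossed edge, so it meets both attached links at its
        -- ends.
        chain a∈ b∈ g∉ (nonTree f∈) h∉ m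
          (_ , vg , visits (onTreePath⇒covers p) j)
          (_ , visits (onTreePath⇒covers p) (joins-sym j) , vh)
          (meets-sym m′)

      chain-exists : P f → Visits f x → Q g → Visits g y → Chain P Q
      chain-exists f∈ vx g∈ vy with near-spanned _ | near-spanned _
      ... | u , su , nu | w , sw , nw =
        crossing (spanWalk su sw) su sw (_ , f∈ , _ , vx , near-sym nu) (_ , g∈ , _ , vy , near-sym nw)

-- Greedy set cover and greedy connection

module _ {A : Set} {P : Pred A 0ℓ} (P? : Decidable P) where

  length-filter-¬ : ∀ xs → length (filter (λ x → ¬? (P? x)) xs) + length (filter P? xs) ≡ length xs
  length-filter-¬ [] = refl
  length-filter-¬ (x ∷ xs) with P? x
  ... | yes _ = trans (+-suc _ _) (cong suc (length-filter-¬ xs))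
  ... | no  _ = cong suc (length-filter-¬ xs)

  length-filter-⊆ : ∀ {Q : Pred A 0ℓ} (Q? : Decidable Q) → (∀ {x} → P x → Q x) →
                    ∀ xs → length (filter P? xs) ≤ length (filter Q? xs)
  length-filter-⊆ Q? P⊆Q [] = z≤n
  length-filter-⊆ Q? P⊆Q (x ∷ xs) with P? x | Q? x
  ... | yes p | yes q = s≤s (length-filter-⊆ Q? P⊆Q xs)
  ... | yes p | no ¬q = contradiction (P⊆Q p) ¬q
  ... | no ¬p | yes q = m≤n⇒m≤1+n (length-filter-⊆ Q? P⊆Q xs)
  ... | no ¬p | no ¬q = length-filter-⊆ Q? P⊆Q xs

  length-filter-⊂ : ∀ {Q : Pred A 0ℓ} (Q? : Decidable Q) → (∀ {x} → P x → Q x) →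
                    ∀ {y xs} → y ∈ˡ xs → Q y → ¬ P y →
                    length (filter P? xs) < length (filter Q? xs)
  length-filter-⊂ Q? P⊆Q {xs = x ∷ xs} y∈ qy ¬py with P? x | Q? x | y∈
  ... | yes p | _     | here refl = contradiction p ¬py
  ... | no ¬p | yes q | here refl = s≤s (length-filter-⊆ Q? P⊆Q xs)
  ... | no ¬p | no ¬q | here refl = contradiction qy ¬q
  ... | yes p | yes q | there y∈′ = s≤s (length-filter-⊂ Q? P⊆Q y∈′ qy ¬py)
  ... | yes p | no ¬q | there y∈′ = contradiction (P⊆Q p) ¬q
  ... | no ¬p | yes q | there y∈′ = m≤n⇒m≤1+n (length-filter-⊂ Q? P⊆Q y∈′ qy ¬py)
  ... | no ¬p | no ¬q | there y∈′ = length-filter-⊂ Q? P⊆Q y∈′ qy ¬py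

-- Averaging: what the first member of `fs` deals with is split off, and the counts of the others
-- cannot grow on the rest. With `fs` a solution and `c` the greedy gain, the greedy choice gets its
-- share of the uncovered nodes.
cover-bound : ∀ {A B : Set} {D : A → Pred B 0ℓ} (D? : ∀ f → Decidable (D f)) c fs U →
              (∀ {x} → x ∈ˡ U → ∃[ f ] f ∈ˡ fs × D f x) →
              (∀ {f} → f ∈ˡ fs → length (filter (D? f) U) ≤ c) → length U ≤ length fs * c
cover-bound D? c [] [] cov ≤c = z≤n
cover-bound D? c [] (x ∷ U) cov ≤c with cov (here refl)
... | _ , () , _
cover-bound {D = D} D? c (f ∷ fs) U cov ≤c = begin
  length U
    ≡⟨ length-filter-¬ (D? f) U ⟨
  length U′ + length (filter (D? f) U)
    ≤⟨ +-mono-≤ (cover-bound D? c fs U′ cov′ ≤c′) (≤c (here refl)) ⟩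
  length fs * c + c
    ≡⟨ +-comm (length fs * c) c ⟩
  suc (length fs) * c
    ∎
  where
  open ≤-Reasoning
  U′ = filter (λ x → ¬? (D? f x)) U
  cov′ : ∀ {x} → x ∈ˡ U′ → ∃[ g ] g ∈ˡ fs × D g x
  cov′ x∈ with ∈-filter⁻ (λ x → ¬? (D? f x)) {xs = U} x∈
  ... | x∈U , ¬d with cov x∈U
  ...   | g , here refl , d = contradiction d ¬d
  ...   | g , there g∈ , d = g , g∈ , d
  ≤c′ : ∀ {g} → g ∈ˡ fs → length (filter (D? g) U′) ≤ c
  ≤c′ {g} g∈ = ≤-trans (shrink U) (≤c (there g∈))
    where
    shrink : ∀ V → length (filter (D? g) (filter (λ x → ¬? (D? f x)) V)) ≤ length (filter (D? g) V)
    shrink [] = z≤n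
    shrink (x ∷ V) with D? f x
    ... | yes _ with does (D? g x)
    ...   | true = m≤n⇒m≤1+n (shrink V)
    ...   | false = shrink V
    shrink (x ∷ V) | no _ with does (D? g x)
    ... | true = s≤s (shrink V)
    ... | false = shrink V

-- `foldr` exposes the last iteration, while the count of greedy steps argues from the first.
foldr-const-commute : ∀ {A B : Set} (h : B → B) z (xs : List A) →
                      foldr (λ _ → h) (h z) xs ≡ h (foldr (λ _ → h) z xs)
foldr-const-commute h z []       = refl
foldr-const-commute h z (_ ∷ xs) = cong h (foldr-const-commute h z xs)

elements : ∀ {n} → Subset n → List (Fin n)
elements []            = []
elements (inside  ∷ p) = zero ∷ map suc (elements p)
elements (outside ∷ p) = map suc (elements p)

length-elements : ∀ {n} (p : Subset n) → length (elements p) ≡ ∣ p ∣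
length-elements []            = refl
length-elements (inside  ∷ p) = cong suc (trans (length-map suc (elements p)) (length-elements p))
length-elements (outside ∷ p) = trans (length-map suc (elements p)) (length-elements p)

∈-elements⁺ : ∀ {n} {p : Subset n} {x} → x ∈ p → x ∈ˡ elements p
∈-elements⁺ {p = inside  ∷ p} here       = here refl
∈-elements⁺ {p = inside  ∷ p} (there x∈) = there (∈-map⁺ suc (∈-elements⁺ x∈))
∈-elements⁺ {p = outside ∷ p} (there x∈) = ∈-map⁺ suc (∈-elements⁺ x∈)

∈-elements⁻ : ∀ {n} (p : Subset n) {x} → x ∈ˡ elements p → x ∈ p
∈-elements⁻ (inside ∷ p) (here refl) = here
∈-elements⁻ (inside ∷ p) (there x∈) with ∈-map⁻ suc x∈
... | y , y∈ , refl = there (∈-elements⁻ p y∈)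
∈-elements⁻ (outside ∷ p) x∈ with ∈-map⁻ suc x∈
... | y , y∈ , refl = there (∈-elements⁻ p y∈)

∣⁅x⁆∪p∣≤1+∣p∣ : ∀ {n} x (p : Subset n) → ∣ ⁅ x ⁆ ∪ p ∣ ≤ suc ∣ p ∣
∣⁅x⁆∪p∣≤1+∣p∣ zero (inside  ∷ p) rewrite ∪-identityˡ p = n≤1+n _
∣⁅x⁆∪p∣≤1+∣p∣ zero (outside ∷ p) rewrite ∪-identityˡ p = ≤-refl
∣⁅x⁆∪p∣≤1+∣p∣ (suc x) (inside  ∷ p) = s≤s (∣⁅x⁆∪p∣≤1+∣p∣ x p)
∣⁅x⁆∪p∣≤1+∣p∣ (suc x) (outside ∷ p) = ∣⁅x⁆∪p∣≤1+∣p∣ x p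

∣p∣≤length : ∀ {n} {p : Subset n} xs → (∀ {x} → x ∈ p → x ∈ˡ xs) → ∣ p ∣ ≤ length xs
∣p∣≤length {n} {p} xs p⊆ = ≤-trans (p⊆q⇒∣p∣≤∣q∣ (∈-⋃ ∘ p⊆)) (∣⋃∣≤ xs)
  where
  ⋃ : List (Fin n) → Subset n
  ⋃ = foldr (λ x q → ⁅ x ⁆ ∪ q) ⊥
  ∈-⋃ : ∀ {x xs} → x ∈ˡ xs → x ∈ ⋃ xs
  ∈-⋃ (here refl) = x∈p∪q⁺ (inj₁ (x∈⁅x⁆ _))
  ∈-⋃ (there x∈)  = x∈p∪q⁺ (inj₂ (∈-⋃ x∈))
  ∣⋃∣≤ : ∀ xs → ∣ ⋃ xs ∣ ≤ length xs
  ∣⋃∣≤ []       = ≤-reflexive (∣⊥∣≡0 n)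
  ∣⋃∣≤ (x ∷ xs) = ≤-trans (∣⁅x⁆∪p∣≤1+∣p∣ x (⋃ xs)) (s≤s (∣⋃∣≤ xs))

-- The number of binary digits. Unlike `⌊log₂_⌋` it also drops from 1 to 0, so that every halving of
-- a positive number is paid for.
bits : ℕ → ℕ
bits zero    = zero
bits (suc n) = suc ⌊log₂ suc n ⌋

log-pos : ∀ {n} → 2 ≤ n → 1 ≤ ⌊log₂ n ⌋
log-pos {n} 2≤n = ≤-trans (≤-reflexive (sym (⌊log₂[2^n]⌋≡n 1))) (⌊log₂⌋-mono-≤ {2} {n} 2≤n)

bits-halve : ∀ n → suc (bits ⌊ suc n /2⌋) ≤ bits (suc n)
bits-halve zero    = s≤s z≤n
bits-halve (suc n) = s≤s (begin
  suc ⌊log₂ ⌊ 2 + n /2⌋ ⌋  ≡⟨ cong suc (⌊log₂⌊n/2⌋⌋≡⌊log₂n⌋∸1 (2 + n)) ⟩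
  suc (⌊log₂ 2 + n ⌋ ∸ 1)  ≡⟨ m+[n∸m]≡n (log-pos {2 + n} (s≤s (s≤s z≤n))) ⟩
  ⌊log₂ 2 + n ⌋            ∎)
  where open ≤-Reasoning

bits≤2*log : ∀ {n} → 2 ≤ n → bits n ≤ 2 * ⌊log₂ n ⌋
bits≤2*log {suc n} 2≤n = begin
  1 + ⌊log₂ suc n ⌋               ≤⟨ +-monoˡ-≤ ⌊log₂ suc n ⌋ (log-pos 2≤n) ⟩
  ⌊log₂ suc n ⌋ + ⌊log₂ suc n ⌋   ≡⟨ cong (⌊log₂ suc n ⌋ +_) (+-identityʳ _) ⟨
  2 * ⌊log₂ suc n ⌋               ∎
  where open ≤-Reasoning

-- Each step adds one element and removes at least a k-th of what is left to do,
-- so k steps halve it.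

module Greedy {A : Set} (h : List A → List A) (u : List A → ℕ) (k : ℕ)
  (grow : ∀ F → (u F ≡ 0 × h F ≡ F) ⊎
                (∃[ g ] ∃[ c ] h F ≡ g ∷ F × u (g ∷ F) + c ≡ u F × u F ≤ k * c × 0 < u F)) where

  run : ∀ {B : Set} → List A → List B → List A
  run F = foldr (λ _ → h) F

  run-done : ∀ {B : Set} F (fuel : List B) → u F ≡ 0 → run F fuel ≡ F
  run-done F []         eq = refl
  run-done F (_ ∷ fuel) eq with grow F
  ... | inj₁ (_ , hF≡F) = trans (cong h (run-done F fuel eq)) hF≡F
  ... | inj₂ (_ , _ , _ , _ , _ , 0<u) = contradiction (sym eq) (<⇒≢ 0<u)

  -- Here `c` is a budget of steps until at most `t` is left, and `b` bounds the additions after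
  -- that. While `u F ≥ t + 1`, a step removes some `d` with `k * d ≥ t + 1`, so `k * u` falls by at
  -- least `t + 1` and one unit of budget pays for it. With no budget left, `k * u F ≤ k * t`.
  -- Multiplying by `k` avoids division.
  length-run-halving : ∀ {B : Set} t b →
    (∀ F (fuel : List B) → u F ≤ t → length (run F fuel) ≤ length F + b) →
    ∀ c F (fuel : List B) → k * u F ≤ c * suc t + k * t → length (run F fuel) ≤ length F + (c + b)
  length-run-halving t b small c F [] le = m≤m+n (length F) (c + b)
  length-run-halving t b small c F (x ∷ fuel) le with u F ≤? t
  ... | yes u≤t = ≤-trans (small F (x ∷ fuel) u≤t) (+-monoʳ-≤ (length F) (m≤n+m b c))
  ... | no  u≰t with grow F
  ...   | inj₁ (u≡0 , _) = contradiction (subst (_≤ t) (sym u≡0) z≤n) u≰t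
  ...   | inj₂ (g , d , hF≡ , dec , u≤kd , 0<u) = next c le
    where
    open ≤-Reasoning
    next : ∀ c → k * u F ≤ c * suc t + k * t → length (run F (x ∷ fuel)) ≤ length F + (c + b)
    next zero le′ = contradiction (*-cancelˡ-≤ k {{k≢0}} le′) u≰t
      where
      k≢0 : NonZero k
      k≢0 = m*n≢0⇒m≢0 k {{>-nonZero (≤-trans 0<u u≤kd)}}
    next (suc c) le′ = begin
      length (run F (x ∷ fuel))     ≡⟨ cong length (foldr-const-commute h F fuel) ⟨
      length (run (h F) fuel)       ≡⟨ cong (λ G → length (run G fuel)) hF≡ ⟩
      length (run (g ∷ F) fuel)     ≤⟨ length-run-halving t b small c (g ∷ F) fuel u-less ⟩
      suc (length F + (c + b))      ≡⟨ +-suc (length F) (c + b) ⟨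
      length F + (suc c + b)        ∎
      where
      u-less : k * u (g ∷ F) ≤ c * suc t + k * t
      u-less = +-cancelˡ-≤ (suc t) _ _ (begin
        suc t + k * u (g ∷ F)      ≤⟨ +-monoˡ-≤ _ (≤-trans (≰⇒> u≰t) u≤kd) ⟩
        k * d + k * u (g ∷ F)      ≡⟨ *-distribˡ-+ k d (u (g ∷ F)) ⟨
        k * (d + u (g ∷ F))        ≡⟨ cong (k *_) (trans (+-comm d _) dec) ⟩
        k * u F                    ≤⟨ le′ ⟩
        suc c * suc t + k * t      ≡⟨ +-assoc (suc t) (c * suc t) (k * t) ⟩
        suc t + (c * suc t + k * t) ∎)

  -- Let `t` be half of `n`, rounded down. From `u F ≤ 2 * t + 1` it follows that `k` is a
  -- sufficient budget for reaching `t`; these `k` steps are charged to one binary digit of `n`.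
  length-run : ∀ {B : Set} n F (fuel : List B) → u F ≤ n → length (run F fuel) ≤ length F + k * bits n
  length-run {B} = <-rec _ bound
    where
    open ≤-Reasoning
    Bound : ℕ → Set
    Bound n = ∀ F (fuel : List B) → u F ≤ n → length (run F fuel) ≤ length F + k * bits n
    bound : ∀ n → (∀ {m} → m < n → Bound m) → Bound n
    bound zero ih F fuel u≤0 =
      ≤-trans (≤-reflexive (cong length (run-done F fuel (n≤0⇒n≡0 u≤0)))) (m≤m+n _ _)
    bound (suc n) ih F fuel u≤n = begin
      length (run F fuel)
        ≤⟨ length-run-halving t (k * bits t) (ih (⌊n/2⌋<n n)) k F fuel k-halve ⟩
      length F + (k + k * bits t)
        ≡⟨ cong (length F +_) (*-suc k (bits t)) ⟨
      length F + k * suc (bits t)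
        ≤⟨ +-monoʳ-≤ (length F) (*-monoʳ-≤ k (bits-halve n)) ⟩
      length F + k * bits (suc n)
        ∎
      where
      t = ⌊ suc n /2⌋
      half : suc n ≤ suc t + t
      half = begin
        suc n                 ≡⟨ ⌊n/2⌋+⌈n/2⌉≡n (suc n) ⟨
        t + ⌈ suc n /2⌉       ≤⟨ +-monoʳ-≤ t (⌊n/2⌋-mono (n≤1+n (2 + n))) ⟩
        t + suc t             ≡⟨ +-comm t (suc t) ⟩
        suc t + t             ∎
      k-halve : k * u F ≤ k * suc t + k * t
      k-halve = begin
        k * u F               ≤⟨ *-monoʳ-≤ k (≤-trans u≤n half) ⟩
        k * (suc t + t)       ≡⟨ *-distribˡ-+ k (suc t) t ⟩
        k * suc t + k * t     ∎

  -- While something is left, `u F ≤ k * c` makes `c` positive. So fuel equal to the initial number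
  -- always finishes the job.
  u-run : ∀ {B : Set} F (fuel : List B) → u (run F fuel) ≤ u F ∸ length fuel
  u-run F []         = ≤-refl
  u-run F (_ ∷ fuel) with grow (run F fuel)
  ... | inj₁ (u≡0 , eq) = ≤-trans (≤-reflexive (trans (cong u eq) u≡0)) z≤n
  ... | inj₂ (g , c , eq , dec , u≤kc , 0<u) = begin
    u (h (run F fuel))          ≡⟨ cong u eq ⟩
    u (g ∷ run F fuel)          ≤⟨ u-less ⟩
    pred (u (run F fuel))       ≤⟨ pred-mono-≤ (u-run F fuel) ⟩
    pred (u F ∸ length fuel)    ≡⟨ pred[m∸n]≡m∸[1+n] (u F) (length fuel) ⟩
    u F ∸ suc (length fuel)     ∎
    where
    open ≤-Reasoning
    0<c : 0 < c
    0<c = >-nonZero⁻¹ c {{m*n≢0⇒n≢0 k {{>-nonZero (≤-trans 0<u u≤kc)}}}}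
    u-less : u (g ∷ run F fuel) ≤ pred (u (run F fuel))
    u-less = <⇒≤pred (<-≤-trans (m<m+n _ 0<c) (≤-reflexive dec))

-- The empty list stands for failure, so that searches can be nested and their results appended
-- directly. The result of the first success is returned.
search : ∀ {A B : Set} → (A → List B) → List A → List B
search g = foldr (λ x acc → if null (g x) then acc else g x) []

search-sat : ∀ {A B : Set} (g : A → List B) (Q : Pred (List B) 0ℓ) xs →
             (∀ {x} → x ∈ˡ xs → g x ≡ [] ⊎ Q (g x)) → search g xs ≡ [] ⊎ Q (search g xs)
search-sat g Q [] sat = inj₁ refl
search-sat g Q (x ∷ xs) sat with g x | sat (here refl)
... | []    | _      = search-sat g Q xs (sat ∘ there)
... | _ ∷ _ | inj₂ q = inj₂ q

search-[] : ∀ {A B : Set} (g : A → List B) {xs x} → search g xs ≡ [] → x ∈ˡ xs → g x ≡ []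
search-[] g {xs = y ∷ xs} eq x∈ with g y in gy | x∈
... | [] | here refl = gy
... | [] | there x∈′ = search-[] g eq x∈′

if-does : ∀ {A P : Set} (P? : Dec P) (x y : A) →
          (P × (if does P? then x else y) ≡ x) ⊎ (¬ P × (if does P? then x else y) ≡ y)
if-does (yes p) x y = inj₁ (p , refl)
if-does (no ¬p) x y = inj₂ (¬p , refl)

best : ∀ {A : Set} → (A → ℕ) → List A → List A
best gain = foldr (λ f acc → if does (any? (λ g → gain f ≤? gain g) acc) then acc else f ∷ []) []

best-spec : ∀ {A : Set} (gain : A → ℕ) fs → (fs ≡ [] × best gain fs ≡ []) ⊎
            (∃[ g ] best gain fs ≡ g ∷ [] × g ∈ˡ fs × (∀ {f} → f ∈ˡ fs → gain f ≤ gain g))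
best-spec gain [] = inj₁ (refl , refl)
best-spec gain (f ∷ fs) with best-spec gain fs
... | inj₁ (refl , eq) rewrite eq = inj₂ (f , refl , here refl , λ { (here refl) → ≤-refl })
... | inj₂ (g , eq , g∈ , max) rewrite eq
  with if-does (any? (λ g → gain f ≤? gain g) (g ∷ [])) (g ∷ []) (f ∷ [])
...   | inj₁ (here f≤g , eq′) = inj₂ (g , eq′ , there g∈ , λ { (here refl) → f≤g ; (there f∈) → max f∈ })
...   | inj₂ (f≰g , eq′)      = inj₂ (f , eq′ , here refl , λ
  { (here refl) → ≤-refl ; (there h∈) → ≤-trans (max h∈) (<⇒≤ (≰⇒> (f≰g ∘ here))) })

module _ {A : Set} {L : A → A → A → A → Set} (L? : ∀ f g h r → Dec (L f g h r)) (links R : List A) where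

  private
    at₃ : A → A → A → A → List A
    at₃ f g h r = if does (L? f g h r) then r ∷ h ∷ g ∷ f ∷ [] else []

    at₂ : A → A → A → List A
    at₂ f g h = search (at₃ f g h) R

    at₁ : A → A → List A
    at₁ f g = search (at₂ f g) links

    at₀ : A → List A
    at₀ f = search (at₁ f) links

  -- The nesting depth is fixed, so exhaustive search is polynomial: there are at most cubically
  -- many triples of links for each candidate in `R`.
  search₄ : List A
  search₄ = search at₀ links

  Found₄ : List A → Set
  Found₄ ys = ∃[ f ] ∃[ g ] ∃[ h ] ∃[ r ] ys ≡ r ∷ h ∷ g ∷ f ∷ [] ×
    (f ∈ˡ links × g ∈ˡ links × h ∈ˡ links × r ∈ˡ R) × L f g h r

  search₄-sound : search₄ ≡ [] ⊎ Found₄ search₄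
  search₄-sound =
    search-sat at₀ Found₄ links λ {f} f∈ → search-sat (at₁ f) Found₄ links λ {g} g∈ →
    search-sat (at₂ f g) Found₄ links λ {h} h∈ → search-sat (at₃ f g h) Found₄ R λ r∈ → leaf f∈ g∈ h∈ r∈
    where
    leaf : ∀ {f g h r} → f ∈ˡ links → g ∈ˡ links → h ∈ˡ links → r ∈ˡ R →
           at₃ f g h r ≡ [] ⊎ Found₄ (at₃ f g h r)
    leaf {f} {g} {h} {r} f∈ g∈ h∈ r∈ with if-does (L? f g h r) (r ∷ h ∷ g ∷ f ∷ []) []
    ... | inj₁ (l , eq) = inj₂ (f , g , h , r , eq , (f∈ , g∈ , h∈ , r∈) , l)
    ... | inj₂ (_ , eq) = inj₁ eq

  search₄-complete : ∀ {f g h r} → f ∈ˡ links → g ∈ˡ links → h ∈ˡ links → r ∈ˡ R →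
                     search₄ ≡ [] → ¬ L f g h r
  search₄-complete {f} {g} {h} {r} f∈ g∈ h∈ r∈ eq l
    with if-does (L? f g h r) (r ∷ h ∷ g ∷ f ∷ []) []
  ... | inj₂ (¬l , _) = ¬l l
  ... | inj₁ (_ , eq′)
    with trans (sym eq′) (search-[] (at₃ f g h) (search-[] (at₂ f g)
           (search-[] (at₁ f) (search-[] at₀ eq f∈) g∈) h∈) r∈)
  ...   | ()

module SetCover {E V : Set} {D : E → V → Set} (D? : ∀ f x → Dec (D f x))
                (links : List E) (points : List V) where

  uncovered : List E → List V
  uncovered = foldr (λ f U → filter (λ x → ¬? (D? f x)) U) points

  gain : List V → E → ℕ
  gain U f = length (filter (D? f) U)

  -- Without this restriction the greedy step would go on adding links of gain zero. It also ensures
  -- that each chosen link dominates some node, hence visits one.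
  useful : List V → List E
  useful U = filter (λ f → any? (D? f) U) links

  extend : List E → List E
  extend F = best (gain (uncovered F)) (useful (uncovered F)) ++ F

  cover : List E
  cover = foldr (λ _ F → extend F) [] points

  uncovered-sound : ∀ F {x} → x ∈ˡ points → x ∈ˡ uncovered F ⊎ (∃[ f ] f ∈ˡ F × D f x)
  uncovered-sound [] x∈ = inj₁ x∈
  uncovered-sound (f ∷ F) {x} x∈ with uncovered-sound F x∈ | D? f x
  ... | _ | yes d = inj₂ (f , here refl , d)
  ... | inj₂ (g , g∈ , d) | no ¬d = inj₂ (g , there g∈ , d)
  ... | inj₁ x∈′ | no ¬d = inj₁ (∈-filter⁺ (λ x → ¬? (D? f x)) x∈′ ¬d)

  uncovered⊆ : ∀ F {x} → x ∈ˡ uncovered F → x ∈ˡ points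
  uncovered⊆ [] x∈ = x∈
  uncovered⊆ (f ∷ F) x∈ =
    uncovered⊆ F (proj₁ (∈-filter⁻ (λ x → ¬? (D? f x)) {xs = uncovered F} x∈))

  Useful : E → Set
  Useful f = f ∈ˡ links × ∃ (D f)

  useful⁻ : ∀ U {f} → f ∈ˡ useful U → Useful f
  useful⁻ U {f} f∈ with ∈-filter⁻ (λ f → any? (D? f) U) {xs = links} f∈
  ... | f∈links , any = f∈links , satisfied any

  extend-useful : ∀ F → All Useful F → All Useful (extend F)
  extend-useful F uF with best-spec (gain (uncovered F)) (useful (uncovered F))
  ... | inj₁ (_ , eq) = subst (All Useful) (sym (cong (_++ F) eq)) uF
  ... | inj₂ (g , eq , g∈ , _) =
    subst (All Useful) (sym (cong (_++ F) eq)) (useful⁻ (uncovered F) g∈ ∷ uF)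

  cover-useful : All Useful cover
  cover-useful = go points
    where
    go : ∀ (fuel : List V) → All Useful (foldr (λ _ F → extend F) [] fuel)
    go []         = []
    go (_ ∷ fuel) = extend-useful _ (go fuel)

  module _ (fs : List E) (fs⊆links : ∀ {f} → f ∈ˡ fs → f ∈ˡ links)
           (covers : ∀ {x} → x ∈ˡ points → ∃[ f ] f ∈ˡ fs × D f x) where

    private
      Growth : List E → Set
      Growth F = (length (uncovered F) ≡ 0 × extend F ≡ F) ⊎
        (∃[ g ] ∃[ c ] extend F ≡ g ∷ F × length (uncovered (g ∷ F)) + c ≡ length (uncovered F) ×
                       length (uncovered F) ≤ length fs * c × 0 < length (uncovered F))

    grow : ∀ F → Growth F
    grow F = by-cases (uncovered F) refl (best-spec (gain U) (useful U))
      where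
      U = uncovered F
      by-cases : ∀ V → uncovered F ≡ V →
                 (useful U ≡ [] × best (gain U) (useful U) ≡ []) ⊎
                 (∃[ g ] best (gain U) (useful U) ≡ g ∷ [] × g ∈ˡ useful U ×
                         (∀ {f} → f ∈ˡ useful U → gain U f ≤ gain U g)) → Growth F
      by-cases [] eq (inj₁ (_ , eq′)) = inj₁ (cong length eq , cong (_++ F) eq′)
      by-cases [] eq (inj₂ (g , _ , g∈ , _))
        with find (proj₂ (∈-filter⁻ (λ f → any? (D? f) U) {xs = links} g∈))
      ... | x , x∈ , _ with subst (x ∈ˡ_) eq x∈
      ...   | ()
      by-cases (x ∷ V) eq (inj₁ (none , _)) with covers (uncovered⊆ F (subst (x ∈ˡ_) (sym eq) (here refl)))
      ... | f , f∈ , d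
        with subst (f ∈ˡ_) none (∈-filter⁺ (λ f → any? (D? f) U) (fs⊆links f∈)
                                  (lose (subst (x ∈ˡ_) (sym eq) (here refl)) d))
      ...   | ()
      by-cases (x ∷ V) eq (inj₂ (g , eq′ , g∈ , max)) = inj₂ (g , gain U g , cong (_++ F) eq′ ,
        length-filter-¬ (D? g) U ,
        cover-bound D? (gain U g) fs U (covers ∘ uncovered⊆ F) gain≤ ,
        subst (λ W → 0 < length W) (sym eq) (s≤s z≤n))
        where
        gain≤ : ∀ {f} → f ∈ˡ fs → gain U f ≤ gain U g
        gain≤ {f} f∈ with any? (D? f) U
        ... | yes any = max (∈-filter⁺ (λ f → any? (D? f) U) (fs⊆links f∈) any)
        ... | no none = ≤-trans (≤-reflexive (cong length (filter-none (D? f) (¬Any⇒All¬ U none)))) z≤n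

    open Greedy extend (length ∘ uncovered) (length fs) grow

    length-cover : length cover ≤ length fs * bits (length points)
    length-cover = length-run (length points) [] points ≤-refl

    cover-covers : ∀ {x} → x ∈ˡ points → ∃[ f ] f ∈ˡ cover × D f x
    cover-covers {x} x∈ with uncovered-sound cover x∈
    ... | inj₂ covered = covered
    ... | inj₁ x∈′ = contradiction x∈′ (empty (uncovered cover) (n≤0⇒n≡0
      (subst (length (uncovered cover) ≤_) (n∸n≡0 (length points)) (u-run [] points))))
      where
      empty : ∀ (xs : List V) → length xs ≡ 0 → ¬ (x ∈ˡ xs)
      empty [] _ ()

module Join {E : Set} (_≟_ : DecidableEquality E)
            {L : List E → E → E → E → E → Set} (L? : ∀ A f g h r → Dec (L A f g h r))
            (links R : List E) where

  open DecMembership _≟_ using () renaming (_∈?_ to _∈ˡ?_)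

  attachment : List E → List E
  attachment A = search₄ (L? A) links R

  -- The start is the first entry of `R`. Under the invariants below each round adds a missing entry
  -- of `R` if there is one, so `length R` rounds suffice; a round adds at most four elements.
  joinSteps : List E → List E
  joinSteps = foldr (λ _ A → attachment A ++ A) (search (_∷ []) R)

  join : List E
  join = joinSteps R

  missing : List E → ℕ
  missing A = length (filter (λ r → ¬? (r ∈ˡ? A)) R)

  length-attachment : ∀ A → length (attachment A) ≤ 4
  length-attachment A with search₄-sound (L? A) links R
  ... | inj₁ eq = subst (λ ys → length ys ≤ 4) (sym eq) z≤n
  ... | inj₂ (_ , _ , _ , _ , eq , _) = subst (λ ys → length ys ≤ 4) (sym eq) ≤-refl

  length-joinSteps : ∀ fuel → length (joinSteps fuel) ≤ 1 + 4 * length fuel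
  length-joinSteps [] with search-sat (_∷ []) (λ ys → length ys ≤ 1) R (λ _ → inj₂ ≤-refl)
  ... | inj₁ eq = subst (λ ys → length ys ≤ 1) (sym eq) z≤n
  ... | inj₂ le = le
  length-joinSteps (x ∷ fuel) = begin
    length (attachment A ++ A)        ≡⟨ length-++ (attachment A) ⟩
    length (attachment A) + length A  ≤⟨ +-mono-≤ (length-attachment A) (length-joinSteps fuel) ⟩
    4 + (1 + 4 * length fuel)         ≡⟨ cong suc (*-suc 4 (length fuel)) ⟨
    1 + 4 * length (x ∷ fuel)         ∎
    where
    open ≤-Reasoning
    A = joinSteps fuel

  length-join : length join ≤ 1 + 4 * length R
  length-join = length-joinSteps R

  module _ (J : List E → Set)
           (J-first : ∀ {r} → r ∈ˡ R → J (r ∷ []))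
           (J-attach : ∀ {A f g h r} → J A → f ∈ˡ links → g ∈ˡ links → h ∈ˡ links → r ∈ˡ R →
                       L A f g h r → J (r ∷ h ∷ g ∷ f ∷ A))
           (L-new : ∀ {A f g h r} → L A f g h r → ¬ (r ∈ˡ A))
           (progress : ∀ {A r} → J A → r ∈ˡ R → ¬ (r ∈ˡ A) → ∃[ f ] ∃[ g ] ∃[ h ] ∃[ r ]
                       (f ∈ˡ links × g ∈ˡ links × h ∈ˡ links × r ∈ˡ R) × L A f g h r)
           (r₀ : E) (r₀∈ : r₀ ∈ˡ R) where

    J-start : J (search (_∷ []) R)
    J-start with search-sat (_∷ []) J R (inj₂ ∘ J-first)
    ... | inj₂ j = j
    ... | inj₁ eq with search-[] (_∷ []) eq r₀∈
    ...   | ()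

    attach-step : ∀ A → J A → J (attachment A ++ A) × missing (attachment A ++ A) ≤ missing A ∸ 1
    attach-step A j with search₄-sound (L? A) links R
    ... | inj₂ (f , g , h , r , eq , (f∈ , g∈ , h∈ , r∈) , l) =
      subst (λ ys → J (ys ++ A) × missing (ys ++ A) ≤ missing A ∸ 1) (sym eq)
        (J-attach j f∈ g∈ h∈ r∈ l ,
         <⇒≤pred (length-filter-⊂ (λ r → ¬? (r ∈ˡ? (_ ∷ _ ∷ _ ∷ _ ∷ A))) (λ r → ¬? (r ∈ˡ? A))
           (λ x∉ x∈ → x∉ (there (there (there (there x∈))))) r∈ (L-new l) (λ r∉ → r∉ (here refl))))
    ... | inj₁ eq = subst (λ ys → J (ys ++ A) × missing (ys ++ A) ≤ missing A ∸ 1) (sym eq)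
        (j , ≤-trans (≤-reflexive none) z≤n)
      where
      none : missing A ≡ 0
      none with any? (λ r → ¬? (r ∈ˡ? A)) R
      ... | no ¬any = cong length (filter-none (λ r → ¬? (r ∈ˡ? A)) (¬Any⇒All¬ R ¬any))
      ... | yes any with find any
      ...   | r , r∈ , r∉ with progress j r∈ r∉
      ...     | f , g , h , r′ , (f∈ , g∈ , h∈ , r′∈) , l =
        contradiction l (search₄-complete (L? A) links R f∈ g∈ h∈ r′∈ eq)

    private
      iterate-sound : ∀ (fuel : List E) →
        J (joinSteps fuel) × missing (joinSteps fuel) ≤ length R ∸ length fuel
      iterate-sound [] = J-start , length-filter (λ r → ¬? (r ∈ˡ? search (_∷ []) R)) R
      iterate-sound (_ ∷ fuel) =
        let (j , m≤)   = iterate-sound fuel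
            (j′ , m′≤) = attach-step _ j
        in j′ , ≤-trans m′≤ (≤-trans (∸-monoˡ-≤ 1 m≤) (≤-reflexive
             (trans (∸-+-assoc (length R) (length fuel) 1) (cong (length R ∸_) (+-comm (length fuel) 1)))))

    join-sound : J join
    join-sound = proj₁ (iterate-sound R)

    R⊆join : ∀ {r} → r ∈ˡ R → r ∈ˡ join
    R⊆join {r} r∈ with r ∈ˡ? join
    ... | yes r∈′ = r∈′
    ... | no r∉ = contradiction (∈-filter⁺ (λ r → ¬? (r ∈ˡ? join)) r∈ r∉)
      (empty (filter (λ r → ¬? (r ∈ˡ? join)) R)
        (n≤0⇒n≡0 (subst (missing join ≤_) (n∸n≡0 (length R)) (proj₂ (iterate-sound R)))))
      where
      empty : ∀ (xs : List E) → length xs ≡ 0 → ¬ (r ∈ˡ xs)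
      empty [] _ ()

-- The approximation algorithm

module Approximation (I : Instance) where

  open Instance I
  open Algorithm I

  links : List Edge
  links = filter (λ f → ¬? (f ∈? tree)) allEdges

  ∈-links⁺ : ∀ {f} → f ∉ tree → f ∈ˡ links
  ∈-links⁺ f∉ = ∈-filter⁺ (λ f → ¬? (f ∈? tree)) (∈-allFin _) f∉

  ∈-links⁻ : ∀ {f} → f ∈ˡ links → f ∉ tree
  ∈-links⁻ f∈ = proj₂ (∈-filter⁻ (λ f → ¬? (f ∈? tree)) {xs = allEdges} f∈)

  Linked : List Edge → Edge → Edge → Edge → Edge → Set
  Linked A f g h r = (Any (λ a → Meets a f) A × Meets f g) × (Meets g h × (Meets h r × ¬ (r ∈ˡ A)))

  opaque
    linked? : ∀ A f g h r → Dec (Linked A f g h r)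
    linked? A f g h r = (any? (λ a → meets? a f) A ×-dec meets? f g) ×-dec
                        (meets? g h ×-dec (meets? h r ×-dec ¬? (r ∈ᵉ? A)))

  module Dominating = SetCover dominates? links allNodes
  open Dominating using (cover)

  module Connecting = Join _≟ᵉ_ linked? links cover
  open Connecting using (join)

  solution : Subset size
  solution = Vec.tabulate (λ e → does (e ∈ᵉ? join))

  ∈-solution⁺ : ∀ {e} → e ∈ˡ join → e ∈ solution
  ∈-solution⁺ {e} e∈ = lookup⇒[]= e solution (trans (lookup∘tabulate _ e) (dec-true (e ∈ᵉ? join) e∈))

  ∈-solution⁻ : ∀ {e} → e ∈ solution → e ∈ˡ join
  ∈-solution⁻ {e} e∈ = witness (e ∈ᵉ? join) (trans (sym (lookup∘tabulate _ e)) ([]=⇒lookup e∈))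
    where
    witness : ∀ {P : Set} (P? : Dec P) → does P? ≡ true → P
    witness (yes p) _ = p

  CoveredBy : List Edge → Pred Edge 0ℓ
  CoveredBy A e = ∃[ f ] f ∈ˡ A × Covers f e

  VisitedBy : List Edge → Pred Node 0ℓ
  VisitedBy A x = ∃[ f ] f ∈ˡ A × Visits f x

  Connected : List Edge → Set
  Connected A = ∀ {x y} → VisitedBy A x → VisitedBy A y → Walk (CoveredBy A) x y

  -- All walks are routed through a node `z` shared by `f` and a member of `A`.
  connected-∷ : ∀ {A f} → Connected A → Any (λ a → Meets a f) A → Connected (f ∷ A)
  connected-∷ {A} {f} conn any vx vy with find any
  ... | a , a∈ , z , va , vf = toZ vx ++ʷ reverseʷ (toZ vy)
    where
    toZ : ∀ {x} → VisitedBy (f ∷ A) x → Walk (CoveredBy (f ∷ A)) x z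
    toZ (_ , here refl , v) = mapʷ (λ c → f , here refl , c) (linkWalk v vf)
    toZ (g , there g∈ , v)  = mapʷ (λ (h , h∈ , c) → h , there h∈ , c) (conn (g , g∈ , v) (a , a∈ , va))

  record Joined (A : List Edge) : Set where
    field
      areLinks  : All (_∉ tree) A
      connected : Connected A
      visited   : ∃ (VisitedBy A)

  open Joined

  joined-[] : ∀ {f x} → f ∉ tree → Visits f x → Joined (f ∷ [])
  joined-[] f∉ v = record
    { areLinks  = f∉ ∷ []
    ; connected = λ { (_ , here refl , vx) (_ , here refl , vy) →
                      mapʷ (λ c → _ , here refl , c) (linkWalk vx vy) }
    ; visited   = _ , _ , here refl , v }

  joined-∷ : ∀ {A f} → Joined A → f ∉ tree → Any (λ a → Meets a f) A → Joined (f ∷ A)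
  joined-∷ J f∉ m = record
    { areLinks  = f∉ ∷ areLinks J
    ; connected = connected-∷ (connected J) m
    ; visited   = let (x , f , f∈ , v) = visited J in x , f , there f∈ , v }

  -- This makes the factor `⌊log₂ order⌋` positive: a covered edge lies in the tree, so it is not a
  -- loop.
  visits⇒2≤order : ∀ {f x} → Visits f x → 2 ≤ order
  visits⇒2≤order (e , (e∈ , _) , _) =
    two (src e) (tgt e) λ eq → no-bypass tree-acyclic e∈ (joins-src-tgt e) (subst (Walk _ (src e)) eq stop)
    where
    two : ∀ {n} (i j : Fin n) → i ≢ j → 2 ≤ n
    two {suc zero}    zero zero i≢j = contradiction refl i≢j
    two {suc (suc n)} _    _    _   = s≤s (s≤s z≤n)

  module _ {F : Subset size} (feasible : Feasible F) where

    open Solution feasible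

    F⊆links : ∀ {f} → f ∈ˡ elements F → f ∈ˡ links
    F⊆links f∈ = ∈-links⁺ (Feasible.nonTree feasible (∈-elements⁻ F f∈))

    F-dominates : ∀ {x} → x ∈ˡ allNodes → ∃[ f ] f ∈ˡ elements F × Dominates f x
    F-dominates {x} _ = let (f , f∈ , d) = dominated x in f , ∈-elements⁺ f∈ , d

    cover-dominates : ∀ x → ∃[ f ] f ∈ˡ cover × Dominates f x
    cover-dominates x = Dominating.cover-covers (elements F) F⊆links F-dominates (∈-allNodes x)

    cover-link : ∀ {f} → f ∈ˡ cover → f ∉ tree
    cover-link f∈ = ∈-links⁻ (proj₁ (All.lookup Dominating.cover-useful f∈))

    cover-visits : ∀ {f} → f ∈ˡ cover → ∃ (Visits f)
    cover-visits f∈ = let (_ , _ , y , v , _) = All.lookup Dominating.cover-useful f∈ in y , v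

    joined-attach : ∀ {A f g h r} → Joined A → f ∈ˡ links → g ∈ˡ links → h ∈ˡ links → r ∈ˡ cover →
                    Linked A f g h r → Joined (r ∷ h ∷ g ∷ f ∷ A)
    joined-attach J f∈ g∈ h∈ r∈ ((mf , mg) , mh , mr , _) =
      joined-∷ (joined-∷ (joined-∷ (joined-∷ J (∈-links⁻ f∈) mf) (∈-links⁻ g∈) (here mg))
                         (∈-links⁻ h∈) (here mh))
               (cover-link r∈) (here mr)

    -- The cover dominates every node, so each node is dominated by `A` or by a link of the cover
    -- missing from `A`. These are the two sides of the chain; its last link is new but need not be
    -- the given `r`.
    progress : ∀ {A r} → Joined A → r ∈ˡ cover → ¬ (r ∈ˡ A) → ∃[ f ] ∃[ g ] ∃[ h ] ∃[ r ]
               (f ∈ˡ links × g ∈ˡ links × h ∈ˡ links × r ∈ˡ cover) × Linked A f g h r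
    progress {A} {r} J r∈ r∉ =
      let (x , f , f∈ , v) = visited J in
      linked (chain-exists {P = _∈ˡ A} {Q = λ f → f ∈ˡ cover × ¬ (f ∈ˡ A)}
        (All.lookup (areLinks J)) (cover-link ∘ proj₁) dominated-by-either
        f∈ v (r∈ , r∉) (proj₂ (cover-visits r∈)))
      where
      either : ∀ {f x} → f ∈ˡ cover → Dominates f x → Dec (f ∈ˡ A) →
               DominatedBy (_∈ˡ A) x ⊎ DominatedBy (λ f → f ∈ˡ cover × ¬ (f ∈ˡ A)) x
      either f∈ d (yes f∈A) = inj₁ (_ , f∈A , d)
      either f∈ d (no  f∉A) = inj₂ (_ , (f∈ , f∉A) , d)
      dominated-by-either : ∀ x → DominatedBy (_∈ˡ A) x ⊎ DominatedBy (λ f → f ∈ˡ cover × ¬ (f ∈ˡ A)) x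
      dominated-by-either x = let (f , f∈ , d) = cover-dominates x in either f∈ d (f ∈ᵉ? A)
      linked : Chain (_∈ˡ A) (λ f → f ∈ˡ cover × ¬ (f ∈ˡ A)) → _
      linked (chain {f₁ = f} {g} {h} {b} a∈ (b∈ , b∉) f∉ g∉ h∉ m₁ m₂ m₃ m₄) =
        f , g , h , b , (∈-links⁺ f∉ , ∈-links⁺ g∉ , ∈-links⁺ h∉ , b∈) ,
        (lose a∈ m₁ , m₂) , m₃ , m₄ , b∉

    first : ∃[ r ] r ∈ˡ cover
    first = let (r , r∈ , _) = cover-dominates (proj₁ (IsTree.nonempty spanning)) in r , r∈

    private
      joined-first : ∀ {r} → r ∈ˡ cover → Joined (r ∷ [])
      joined-first r∈ = joined-[] (cover-link r∈) (proj₂ (cover-visits r∈))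

    join-joined : Joined join
    join-joined = Connecting.join-sound Joined joined-first joined-attach
      (λ l → proj₂ (proj₂ (proj₂ l))) progress (proj₁ first) (proj₂ first)

    cover⊆join : ∀ {r} → r ∈ˡ cover → r ∈ˡ join
    cover⊆join = Connecting.R⊆join Joined joined-first joined-attach
      (λ l → proj₂ (proj₂ (proj₂ l))) progress (proj₁ first) (proj₂ first)

    solution-feasible : Feasible solution
    solution-feasible = record
      { nonTree    = All.lookup (areLinks join-joined) ∘ ∈-solution⁻
      ; isTree     = record
        { nonempty  = let (x , f , f∈ , v) = visited join-joined in
                      x , visits⇒coveredNode (∈-solution⁺ f∈) v
        ; connected = λ cx cy → mapʷ (λ (f , f∈ , c) → f , ∈-solution⁺ f∈ , covers⇒onTreePath c)
            (connected join-joined (visitedBy cx) (visitedBy cy))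
        ; acyclic   = acyclic-⊆ (λ (f , _ , p) → proj₁ (onTreePath⇒covers p)) tree-acyclic }
      ; dominating = λ v ¬c → let (f , f∈ , y , vy , n) = cover-dominates v in
                     neighbour v ¬c (visits⇒coveredNode (∈-solution⁺ (cover⊆join f∈)) vy) n }
      where
      visitedBy : ∀ {x} → CoveredNode tree solution x → VisitedBy join x
      visitedBy c = let (f , f∈ , v) = coveredNode⇒visits c in f , ∈-solution⁻ f∈ , v
      neighbour : ∀ v {y} → ¬ CoveredNode tree solution v → CoveredNode tree solution y → Near v y →
                  ∃[ u ] CoveredNode tree solution u × ∃[ e ] Joins e v u
      neighbour v ¬c c (inj₁ refl)    = contradiction c ¬c
      neighbour v ¬c c (inj₂ (e , j)) = _ , c , e , j

    solution-size : ∣ solution ∣ ≤ (10 * ⌊log₂ order ⌋) * ∣ F ∣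
    solution-size = begin
      ∣ solution ∣                        ≤⟨ ∣p∣≤length join ∈-solution⁻ ⟩
      length join                         ≤⟨ Connecting.length-join ⟩
      -- The initial link is charged to the cover, which is nonempty.
      1 + 4 * length cover                ≤⟨ +-monoˡ-≤ (4 * length cover) (nonempty (proj₂ first)) ⟩
      5 * length cover                    ≤⟨ *-monoʳ-≤ 5 cover-size ⟩
      5 * (∣ F ∣ * bits order)            ≤⟨ *-monoʳ-≤ 5 (*-monoʳ-≤ ∣ F ∣ (bits≤2*log 2≤order)) ⟩
      5 * (∣ F ∣ * (2 * ⌊log₂ order ⌋))   ≡⟨ cong (5 *_) (*-comm ∣ F ∣ _) ⟩
      5 * (2 * ⌊log₂ order ⌋ * ∣ F ∣)     ≡⟨ *-assoc 5 (2 * ⌊log₂ order ⌋) ∣ F ∣ ⟨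
      5 * (2 * ⌊log₂ order ⌋) * ∣ F ∣     ≡⟨ cong (_* ∣ F ∣) (*-assoc 5 2 ⌊log₂ order ⌋) ⟨
      10 * ⌊log₂ order ⌋ * ∣ F ∣          ∎
      where
      open ≤-Reasoning
      nonempty : ∀ {r : Edge} {rs} → r ∈ˡ rs → 1 ≤ length rs
      nonempty (here _)  = s≤s z≤n
      nonempty (there _) = s≤s z≤n
      2≤order : 2 ≤ order
      2≤order = visits⇒2≤order (proj₂ (cover-visits (proj₂ first)))
      cover-size : length cover ≤ ∣ F ∣ * bits order
      cover-size = subst₂ (λ k n → length cover ≤ k * bits n) (length-elements F) length-allNodes
        (Dominating.length-cover (elements F) F⊆links F-dominates)

-- Polynomial-time programs

infixl 6 _⊕_
infixl 7 _⊗_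

-- Syntax makes composition of bounds a substitution. Natural coefficients make every polynomial
-- monotone.
data Polynomial : Set where
  con     : ℕ → Polynomial
  X       : Polynomial
  _⊕_ _⊗_ : Polynomial → Polynomial → Polynomial

eval : Polynomial → ℕ → ℕ
eval (con c) s = c
eval X       s = s
eval (p ⊕ q) s = eval p s + eval q s
eval (p ⊗ q) s = eval p s * eval q s

_⟨_⟩ : Polynomial → Polynomial → Polynomial
con c   ⟨ r ⟩ = con c
X       ⟨ r ⟩ = r
(p ⊕ q) ⟨ r ⟩ = p ⟨ r ⟩ ⊕ q ⟨ r ⟩
(p ⊗ q) ⟨ r ⟩ = p ⟨ r ⟩ ⊗ q ⟨ r ⟩

eval-mono : ∀ p {s t} → s ≤ t → eval p s ≤ eval p t
eval-mono (con c) s≤t = ≤-refl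
eval-mono X       s≤t = s≤t
eval-mono (p ⊕ q) s≤t = +-mono-≤ (eval-mono p s≤t) (eval-mono q s≤t)
eval-mono (p ⊗ q) s≤t = *-mono-≤ (eval-mono p s≤t) (eval-mono q s≤t)

eval-⟨⟩ : ∀ p r s → eval (p ⟨ r ⟩) s ≡ eval p (eval r s)
eval-⟨⟩ (con c) r s = refl
eval-⟨⟩ X       r s = refl
eval-⟨⟩ (p ⊕ q) r s = cong₂ _+_ (eval-⟨⟩ p r s) (eval-⟨⟩ q r s)
eval-⟨⟩ (p ⊗ q) r s = cong₂ _*_ (eval-⟨⟩ p r s) (eval-⟨⟩ q r s)

eval-≤⟨⟩ : ∀ p r {m} s → m ≤ eval r s → eval p m ≤ eval (p ⟨ r ⟩) s
eval-≤⟨⟩ p r s m≤ = ≤-trans (eval-mono p m≤) (≤-reflexive (sym (eval-⟨⟩ p r s)))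

eval≤monomial : ∀ p → ∃[ c ] ∃[ d ] ∀ s .{{_ : NonZero s}} → eval p s ≤ c * s ^ d
eval≤monomial (con c) = c , 0 , λ s → ≤-reflexive (sym (*-identityʳ c))
eval≤monomial X       = 1 , 1 , λ s →
  ≤-reflexive (sym (trans (*-identityˡ (s ^ 1)) (*-identityʳ s)))
eval≤monomial (p ⊕ q) with eval≤monomial p | eval≤monomial q
... | c , d , p≤ | c′ , d′ , q≤ = c + c′ , d + d′ , λ s →
  ≤-trans
    (+-mono-≤ (≤-trans (p≤ s) (*-monoʳ-≤ c (^-monoʳ-≤ s (m≤m+n d d′))))
              (≤-trans (q≤ s) (*-monoʳ-≤ c′ (^-monoʳ-≤ s (m≤n+m d′ d)))))
    (≤-reflexive (sym (*-distribʳ-+ (s ^ (d + d′)) c c′)))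
eval≤monomial (p ⊗ q) with eval≤monomial p | eval≤monomial q
... | c , d , p≤ | c′ , d′ , q≤ = c * c′ , d + d′ , λ s →
  ≤-trans (*-mono-≤ (p≤ s) (q≤ s)) (≤-reflexive (begin
    (c * s ^ d) * (c′ * s ^ d′) ≡⟨ [m*n]*[o*p]≡[m*o]*[n*p] c (s ^ d) c′ (s ^ d′) ⟩
    (c * c′) * (s ^ d * s ^ d′) ≡⟨ cong ((c * c′) *_) (^-distribˡ-+-* s d d′) ⟨
    (c * c′) * s ^ (d + d′)     ∎))
  where open ≡-Reasoning

∥∥-pos : ∀ x → 1 ≤ ∥ x ∥
∥∥-pos nil     = s≤s z≤n
∥∥-pos (x ∙ y) = s≤s z≤n

-- Data types, their codes and polynomial-time functions.

infixl 5 _×ᵗ_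

data Ty : Set where
  bool nat unit node edge inst raw : Ty
  list : Ty → Ty
  _×ᵗ_ : Ty → Ty → Ty

El : Ty → Instance → Set
El bool     I = Bool
El nat      I = ℕ
El unit     I = ⊤
El node     I = Instance.Node I
El edge     I = Instance.Edge I
El inst     I = ⊤
El raw      I = ⊤
El (list A) I = List (El A I)
El (A ×ᵗ B) I = El A I × El B I

encodeNode : ∀ I → Instance.Node I → D
encodeNode I x = encodeℕ (toℕ x)

-- An edge is coded together with its ends and its membership in the tree, so that
-- a program can read them off.

encodeEdge : ∀ I → Instance.Edge I → D
encodeEdge I e = encodeℕ (toℕ (opposite e)) ∙
  ((encodeNode I (Algorithm.src I e) ∙ encodeNode I (Algorithm.tgt I e)) ∙
   encodeBool (lookup (Instance.tree I) e))

-- inst and raw are one-element types: their element is the instance, coded by the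
-- lists of all its nodes and edges and as in the statement, respectively.

enc : ∀ A {I} → El A I → D
enc bool      b       = encodeBool b
enc nat       n       = encodeℕ n
enc unit      _       = nil
enc node  {I} x       = encodeNode I x
enc edge  {I} e       = encodeEdge I e
enc inst  {I} _       = encodeList (encodeNode I) (Algorithm.allNodes I) ∙
                        encodeList (encodeEdge I) (Algorithm.allEdges I)
enc raw   {I} _       = encodeInstance I
enc (list A)  xs      = encodeList (enc A) xs
enc (A ×ᵗ B)  (x , y) = enc A x ∙ enc B y

-- FP A B f: f is computable in polynomial time.

record FP (A B : Ty) (f : ∀ I → El A I → El B I) : Set where
  field
    code      : Exp 1 1
    time      : ∀ {I} → El A I → ℕ
    runs      : ∀ {I} a → code , enc A a ∷ [] ⊢ code ⇓ enc B (f I a) ∣ time {I} a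
    timeBound : Polynomial
    time≤     : ∀ {I} a → time {I} a ≤ eval timeBound ∥ enc A a ∥
    sizeBound : Polynomial
    size≤     : ∀ {I} a → ∥ enc B (f I a) ∥ ≤ eval sizeBound ∥ enc A {I} a ∥

open FP

-- Values of different types may have equal codes; then the same program computes both functions.
-- This gives access to the parts of an edge or of the instance at no cost.
recode : ∀ {A A′ B B′ f f′} (h : ∀ {I} → El A′ I → El A I) →
         (∀ {I} a → enc A (h {I} a) ≡ enc A′ a) →
         (∀ {I} a → enc B (f I (h a)) ≡ enc B′ (f′ I a)) →
         FP A B f → FP A′ B′ f′
recode {A} {A′} {B} {B′} {f} {f′} h eqA eqB F = record
  { code      = code F
  ; time      = λ a → time F (h a)
  ; runs      = λ a → subst₂ (λ x y → code F , x ∷ [] ⊢ code F ⇓ y ∣ time F (h a))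
                             (eqA a) (eqB a) (runs F (h a))
  ; timeBound = timeBound F
  ; time≤     = λ a → subst (λ x → time F (h a) ≤ eval (timeBound F) ∥ x ∥) (eqA a) (time≤ F (h a))
  ; sizeBound = sizeBound F
  ; size≤     = λ a → subst₂ (λ x y → ∥ y ∥ ≤ eval (sizeBound F) ∥ x ∥) (eqA a) (eqB a) (size≤ F (h a))
  }

recodeʳ : ∀ {A B B′ f f′} → (∀ {I} a → enc B (f I a) ≡ enc B′ (f′ I a)) → FP A B f → FP A B′ f′
recodeʳ {A} = recode {A} {A} id (λ _ → refl)

ext : ∀ {A B f f′} → (∀ {I} a → f I a ≡ f′ I a) → FP A B f → FP A B f′
ext {B = B} eq = recodeʳ λ a → cong (enc B) (eq a)

idᶠ : ∀ {A} → FP A A (λ _ a → a)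
idᶠ = record
  { code = var zero ; time = λ _ → 1 ; runs = λ _ → var zero
  ; timeBound = con 1 ; time≤ = λ _ → ≤-refl
  ; sizeBound = X ; size≤ = λ _ → ≤-refl }

infixr 9 _∘ᶠ_

-- The time of the outer program depends on the size of the intermediate result, which is why `FP`
-- records a size bound too.
_∘ᶠ_ : ∀ {A B C g f} → FP B C g → FP A B f → FP A C (λ I a → g I (f I a))
_∘ᶠ_ {f = f} G F = record
  { code      = call (code G) (call (code F) (var zero ∷ []) ∷ [])
  ; time      = λ a → suc ((suc (1 + time F a) + 0) + time G (f _ a))
  ; runs      = λ a → call (call (var zero ∷ []) (runs F a) ∷ []) (runs G (f _ a))
  ; timeBound = con 1 ⊕ ((con 2 ⊕ timeBound F ⊕ con 0) ⊕ timeBound G ⟨ sizeBound F ⟩)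
  ; time≤     = λ a → s≤s (+-mono-≤ (+-monoˡ-≤ 0 (s≤s (s≤s (time≤ F a))))
      (≤-trans (time≤ G (f _ a)) (eval-≤⟨⟩ (timeBound G) (sizeBound F) _ (size≤ F a))))
  ; sizeBound = sizeBound G ⟨ sizeBound F ⟩
  ; size≤     = λ a → ≤-trans (size≤ G (f _ a)) (eval-≤⟨⟩ (sizeBound G) (sizeBound F) _ (size≤ F a))
  }

infixl 5 _,ᶠ_

_,ᶠ_ : ∀ {A B C f g} → FP A B f → FP A C g → FP A (B ×ᵗ C) (λ I a → f I a , g I a)
F ,ᶠ G = record
  { code      = cons (call (code F) (var zero ∷ [])) (call (code G) (var zero ∷ []))
  ; time      = λ a → suc (suc (1 + time F a) + suc (1 + time G a))
  ; runs      = λ a → cons (call (var zero ∷ []) (runs F a)) (call (var zero ∷ []) (runs G a))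
  ; timeBound = con 1 ⊕ ((con 2 ⊕ timeBound F) ⊕ (con 2 ⊕ timeBound G))
  ; time≤     = λ a → s≤s (+-mono-≤ (s≤s (s≤s (time≤ F a))) (s≤s (s≤s (time≤ G a))))
  ; sizeBound = con 1 ⊕ (sizeBound F ⊕ sizeBound G)
  ; size≤     = λ a → s≤s (+-mono-≤ (size≤ F a) (size≤ G a))
  }

fstᶠ : ∀ {A B} → FP (A ×ᵗ B) A (λ _ → proj₁)
fstᶠ = record
  { code = case (var zero) nil (var zero) ; time = λ _ → 3
  ; runs = λ _ → caseCons (var zero) (var zero)
  ; timeBound = con 3 ; time≤ = λ _ → ≤-refl
  ; sizeBound = X ; size≤ = λ _ → m≤n⇒m≤1+n (m≤m+n _ _) }

sndᶠ : ∀ {A B} → FP (A ×ᵗ B) B (λ _ → proj₂)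
sndᶠ = record
  { code = case (var zero) nil (var (suc zero)) ; time = λ _ → 3
  ; runs = λ _ → caseCons (var zero) (var (suc zero))
  ; timeBound = con 3 ; time≤ = λ _ → ≤-refl
  ; sizeBound = X ; size≤ = λ _ → m≤n⇒m≤1+n (m≤n+m _ _) }

nilᶠ : ∀ {A B} → FP A (list B) (λ _ _ → [])
nilᶠ = record
  { code = nil ; time = λ _ → 1 ; runs = λ _ → nil
  ; timeBound = con 1 ; time≤ = λ _ → ≤-refl
  ; sizeBound = con 1 ; size≤ = λ _ → ≤-refl }

infixr 5 _∷ᶠ_

_∷ᶠ_ : ∀ {A B f g} → FP A B f → FP A (list B) g → FP A (list B) (λ I a → f I a ∷ g I a)
_∷ᶠ_ {A} {B} F G = recodeʳ {B = B ×ᵗ list B} (λ _ → refl) (F ,ᶠ G)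

falseᶠ : ∀ {A} → FP A bool (λ _ _ → false)
falseᶠ {A} = recodeʳ {B = list unit} (λ _ → refl) nilᶠ

zeroᶠ : ∀ {A} → FP A nat (λ _ _ → 0)
zeroᶠ {A} = recodeʳ {B = list unit} (λ _ → refl) nilᶠ

unitᶠ : ∀ {A} → FP A unit (λ _ _ → tt)
unitᶠ {A} = recodeʳ {B = list unit} (λ _ → refl) nilᶠ

sucᶠ : ∀ {A f} → FP A nat f → FP A nat (λ I a → suc (f I a))
sucᶠ {A} F = recodeʳ {B = unit ×ᵗ nat} (λ _ → refl) (unitᶠ ,ᶠ F)

trueᶠ : ∀ {A} → FP A bool (λ _ _ → true)
trueᶠ {A} = recodeʳ {B = unit ×ᵗ unit} (λ _ → refl) (unitᶠ ,ᶠ unitᶠ)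

module _ {A B} {c : ∀ I → El A I → Bool} {f g : ∀ I → El A I → El B I}
         (C : FP A bool c) (F : FP A B f) (G : FP A B g) where

  private
    ite : ∀ I → El A I → El B I
    ite I a = if c I a then f I a else g I a

    iteCode : Exp 1 1
    iteCode = case (call (code C) (var zero ∷ [])) (call (code G) (var zero ∷ []))
                   (call (code F) (var (suc (suc zero)) ∷ []))

    iteBound : Polynomial
    iteBound = con 1 ⊕ ((con 2 ⊕ timeBound C) ⊕ (con 2 ⊕ (timeBound F ⊕ timeBound G)))

    run : ∀ {I} a → ∃[ t ] (iteCode , enc A a ∷ [] ⊢ iteCode ⇓ enc B (ite I a) ∣ t)
                         × t ≤ eval iteBound ∥ enc A a ∥
    run {I} a with c I a | runs C {I} a
    ... | true  | r = _ , caseCons (call (var zero ∷ []) r)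
                                   (call (var (suc (suc zero)) ∷ []) (runs F a)) ,
      s≤s (+-mono-≤ (s≤s (s≤s (time≤ C a))) (s≤s (s≤s (≤-trans (time≤ F a) (m≤m+n _ _)))))
    ... | false | r = _ , caseNil (call (var zero ∷ []) r) (call (var zero ∷ []) (runs G a)) ,
      s≤s (+-mono-≤ (s≤s (s≤s (time≤ C a))) (s≤s (s≤s (≤-trans (time≤ G a) (m≤n+m _ _)))))

    ite-size : ∀ {I} a → ∥ enc B (ite I a) ∥ ≤ eval (sizeBound F ⊕ sizeBound G) ∥ enc A a ∥
    ite-size {I} a with c I a
    ... | true  = ≤-trans (size≤ F a) (m≤m+n _ _)
    ... | false = ≤-trans (size≤ G a) (m≤n+m _ _)

  ifᶠ : FP A B (λ I a → if c I a then f I a else g I a)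
  ifᶠ = record
    { code = iteCode ; time = λ a → proj₁ (run a) ; runs = λ a → proj₁ (proj₂ (run a))
    ; timeBound = iteBound ; time≤ = λ a → proj₂ (proj₂ (run a))
    ; sizeBound = sizeBound F ⊕ sizeBound G ; size≤ = ite-size }

length≤∥∥ : ∀ {A : Set} (f : A → D) xs → length xs ≤ ∥ encodeList f xs ∥
length≤∥∥ f []       = z≤n
length≤∥∥ f (x ∷ xs) = s≤s (≤-trans (length≤∥∥ f xs) (m≤n+m _ _))

-- Recursion on lists is polynomial provided the results are of polynomial size.

module _ {Γ A B} {z : ∀ I → El Γ I → El B I} {s : ∀ I → El (Γ ×ᵗ A ×ᵗ B) I → El B I}
         (Z : FP Γ B z) (S : FP (Γ ×ᵗ A ×ᵗ B) B s) (R : Polynomial) where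

  private
    rec : ∀ I → El Γ I → List (El A I) → El B I
    rec I γ = foldr (λ x acc → s I ((γ , x) , acc)) (z I γ)

  module _ (rec≤ : ∀ {I} γ xs → ∥ enc B (rec I γ xs) ∥ ≤ eval R ∥ enc (Γ ×ᵗ list A) {I} (γ , xs) ∥) where

    private
      recCode : Exp 1 1
      recCode = case (var zero) nil (case (var (suc zero)) (call (code Z) (var zero ∷ []))
        (call (code S) (cons (cons (var (suc (suc zero))) (var zero))
                             (self (cons (var (suc (suc zero))) (var (suc zero)) ∷ [])) ∷ [])))

      stepBound : Polynomial
      -- The overhead is 6 at the empty list and 13 per element; 20 covers both. The argument of `S`
      -- consists of a part of the input and a result of size at most `R`.
      stepBound = con 20 ⊕ (timeBound Z ⊕ timeBound S ⟨ con 1 ⊕ (X ⊕ R) ⟩)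

      -- The bound `n` stays fixed while the list shrinks, so the recursive calls share one bound
      -- per step.
      run : ∀ {I} n γ xs → ∥ enc (Γ ×ᵗ list A) {I} (γ , xs) ∥ ≤ n → ∃[ t ]
            (recCode , enc (Γ ×ᵗ list A) {I} (γ , xs) ∷ [] ⊢ recCode ⇓ enc B (rec I γ xs) ∣ t)
            × t ≤ suc (length xs) * eval stepBound n
      run n γ [] ≤n = _ ,
        caseCons (var zero) (caseNil (var (suc zero)) (call (var zero ∷ []) (runs Z γ))) ,
        (begin
          6 + time Z γ              ≤⟨ +-mono-≤ (m≤m+n 6 14) (≤-trans (time≤ Z γ) (eval-mono (timeBound Z) γ≤)) ⟩
          20 + eval (timeBound Z) n ≤⟨ +-monoʳ-≤ 20 (m≤m+n _ _) ⟩
          eval stepBound n          ≡⟨ *-identityˡ _ ⟨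
          1 * eval stepBound n      ∎)
        where
        open ≤-Reasoning
        γ≤ : ∥ enc Γ γ ∥ ≤ n
        γ≤ = m+n≤o⇒m≤o _ (≤-trans (n≤1+n _) ≤n)
      run {I} n γ (x ∷ xs) ≤n
        with run n γ xs (≤-trans (s≤s (+-monoʳ-≤ ∥ enc Γ γ ∥ (m≤n⇒m≤1+n (m≤n+m _ _)))) ≤n)
      ... | t , r , t≤ = _ ,
        caseCons (var zero) (caseCons (var (suc zero))
          (call (cons (cons (var (suc (suc zero))) (var zero))
                      (self (cons (var (suc (suc zero))) (var (suc zero)) ∷ []) r) ∷ [])
                (runs S ((γ , x) , rec I γ xs)))) ,
        (begin
          _
            ≡⟨ count t (time S ((γ , x) , rec I γ xs)) ⟩
          13 + time S ((γ , x) , rec I γ xs) + t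
            ≤⟨ +-mono-≤ (+-mono-≤ (m≤m+n 13 7) (≤-trans (time≤ S _)
                 (eval-≤⟨⟩ (timeBound S) (con 1 ⊕ (X ⊕ R)) n in≤))) t≤ ⟩
          20 + eval (timeBound S ⟨ con 1 ⊕ (X ⊕ R) ⟩) n + suc (length xs) * eval stepBound n
            ≤⟨ +-monoˡ-≤ (suc (length xs) * eval stepBound n)
                 (+-monoʳ-≤ 20 (m≤n+m _ (eval (timeBound Z) n))) ⟩
          suc (suc (length xs)) * eval stepBound n
            ∎)
        where
        open ≤-Reasoning
        count : ∀ t u → suc (1 + suc (1 + suc (suc (suc (1 + 1) + suc (suc (1 + 1) + 0 + t)) + 0 + u)))
                        ≡ 13 + u + t
        count = solve-∀
        head≤ : suc (∥ enc Γ γ ∥ + ∥ enc A x ∥) ≤ n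
        head≤ = ≤-trans (s≤s (+-monoʳ-≤ ∥ enc Γ γ ∥ (m≤n⇒m≤1+n (m≤m+n _ _)))) ≤n
        in≤ : ∥ enc (Γ ×ᵗ A ×ᵗ B) {I} ((γ , x) , rec I γ xs) ∥ ≤ 1 + (n + eval R n)
        in≤ = s≤s (+-mono-≤ head≤ (≤-trans (rec≤ γ xs)
          (eval-mono R (≤-trans (s≤s (+-monoʳ-≤ ∥ enc Γ γ ∥ (m≤n⇒m≤1+n (m≤n+m _ _)))) ≤n))))

    recᶠ : FP (Γ ×ᵗ list A) B (λ I (γ , xs) → foldr (λ x acc → s I ((γ , x) , acc)) (z I γ) xs)
    recᶠ = record
      { code = recCode
      ; time = λ (γ , xs) → proj₁ (run _ γ xs ≤-refl)
      ; runs = λ (γ , xs) → proj₁ (proj₂ (run _ γ xs ≤-refl))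
      ; timeBound = (con 1 ⊕ X) ⊗ stepBound
      ; time≤ = λ {I} (γ , xs) → ≤-trans (proj₂ (proj₂ (run _ γ xs ≤-refl)))
          (*-monoˡ-≤ (eval stepBound ∥ enc (Γ ×ᵗ list A) {I} (γ , xs) ∥)
            (s≤s (≤-trans (length≤∥∥ (enc A) xs) (m≤n⇒m≤1+n (m≤n+m _ ∥ enc Γ γ ∥)))))
      ; sizeBound = R ; size≤ = λ (γ , xs) → rec≤ γ xs }

-- Contexts that contain the instance, their variables, and basic programs.

record Ctx (Γ : Ty) : Set where
  field
    instᶠ : FP Γ inst (λ _ _ → tt)
    inst≤ : ∀ {I} (γ : El Γ I) → ∥ enc inst {I} tt ∥ ≤ ∥ enc Γ γ ∥

open Ctx {{...}} public

instance
  ctx-inst : Ctx inst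
  ctx-inst = record { instᶠ = idᶠ ; inst≤ = λ _ → ≤-refl }

  ctx-× : ∀ {Γ A} → {{Ctx Γ}} → Ctx (Γ ×ᵗ A)
  ctx-× = record { instᶠ = instᶠ ∘ᶠ fstᶠ
                 ; inst≤ = λ (γ , _) → ≤-trans (inst≤ γ) (m≤n⇒m≤1+n (m≤m+n _ _)) }

v₀ : ∀ {Γ A} → FP (Γ ×ᵗ A) A (λ _ → proj₂)
v₀ = sndᶠ

v₁ : ∀ {Γ A B} → FP (Γ ×ᵗ A ×ᵗ B) A (λ _ a → proj₂ (proj₁ a))
v₁ = v₀ ∘ᶠ fstᶠ

v₂ : ∀ {Γ A B C} → FP (Γ ×ᵗ A ×ᵗ B ×ᵗ C) A (λ _ a → proj₂ (proj₁ (proj₁ a)))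
v₂ = v₁ ∘ᶠ fstᶠ

v₃ : ∀ {Γ A B C E} → FP (Γ ×ᵗ A ×ᵗ B ×ᵗ C ×ᵗ E) A (λ _ a → proj₂ (proj₁ (proj₁ (proj₁ a))))
v₃ = v₂ ∘ᶠ fstᶠ

v₄ : ∀ {Γ A B C E G} → FP (Γ ×ᵗ A ×ᵗ B ×ᵗ C ×ᵗ E ×ᵗ G) A (λ _ a → proj₂ (proj₁ (proj₁ (proj₁ (proj₁ a)))))
v₄ = v₃ ∘ᶠ fstᶠ

notᶠ : ∀ {Γ b} → FP Γ bool b → FP Γ bool (λ I γ → not (b I γ))
notᶠ {b = b} B = ext (λ {I} γ → eq (b I γ)) (ifᶠ B falseᶠ trueᶠ)
  where
  eq : ∀ b → (if b then false else true) ≡ not b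
  eq false = refl
  eq true  = refl

infixr 6 _∧ᶠ_
infixr 5 _∨ᶠ_

_∧ᶠ_ : ∀ {Γ b c} → FP Γ bool b → FP Γ bool c → FP Γ bool (λ I γ → b I γ ∧ c I γ)
_∧ᶠ_ {b = b} {c} B C = ext (λ {I} γ → eq (b I γ) (c I γ)) (ifᶠ B C falseᶠ)
  where
  eq : ∀ b c → (if b then c else false) ≡ b ∧ c
  eq false c = refl
  eq true  c = refl

_∨ᶠ_ : ∀ {Γ b c} → FP Γ bool b → FP Γ bool c → FP Γ bool (λ I γ → b I γ ∨ c I γ)
_∨ᶠ_ {b = b} {c} B C = ext (λ {I} γ → eq (b I γ) (c I γ)) (ifᶠ B trueᶠ C)
  where
  eq : ∀ b c → (if b then true else c) ≡ b ∨ c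
  eq false c = refl
  eq true  c = refl

encodeBool≤3 : ∀ b → ∥ encodeBool b ∥ ≤ 3
encodeBool≤3 false = s≤s z≤n
encodeBool≤3 true  = ≤-refl

module _ {Γ A B} {xs : ∀ I → El Γ I → List (El A I)} {z s}
         (XS : FP Γ (list A) xs) (Z : FP Γ B z) (S : FP (Γ ×ᵗ A ×ᵗ B) B s) (R : Polynomial)
         (rec≤ : ∀ {I} γ xs → ∥ enc B (foldr (λ x acc → s I ((γ , x) , acc)) (z I γ) xs) ∥ ≤
                              eval R ∥ enc (Γ ×ᵗ list A) {I} (γ , xs) ∥) where

  foldrᶠ : FP Γ B (λ I γ → foldr (λ x acc → s I ((γ , x) , acc)) (z I γ) (xs I γ))
  foldrᶠ = recᶠ Z S R rec≤ ∘ᶠ (idᶠ ,ᶠ XS)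

anyᶠ : ∀ {Γ A} {xs : ∀ I → El Γ I → List (El A I)} {P : ∀ I → El (Γ ×ᵗ A) I → Set}
       {P? : ∀ I a → Dec (P I a)} →
       FP Γ (list A) xs → FP (Γ ×ᵗ A) bool (λ I a → does (P? I a)) →
       FP Γ bool (λ I γ → does (any? (λ x → P? I (γ , x)) (xs I γ)))
anyᶠ {Γ} {A} {xs} {P} {P?} XS B = ext (λ {I} γ → eq γ (xs I γ))
  (foldrᶠ XS falseᶠ ((B ∘ᶠ fstᶠ) ∨ᶠ v₀) (con 3) (λ γ xs → encodeBool≤3 _))
  where
  eq : ∀ {I} γ xs → foldr (λ x acc → does (P? I (γ , x)) ∨ acc) false xs ≡
                    does (any? (λ x → P? I (γ , x)) xs)
  eq γ []       = refl
  eq {I} γ (x ∷ xs) = cong (does (P? I (γ , x)) ∨_) (eq γ xs)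

∥filter∥≤ : ∀ {A : Set} (f : A → D) (p : A → Bool) xs →
            ∥ encodeList f (foldr (λ x acc → if p x then x ∷ acc else acc) [] xs) ∥ ≤ ∥ encodeList f xs ∥
∥filter∥≤ f p [] = ≤-refl
∥filter∥≤ f p (x ∷ xs) with p x
... | true  = s≤s (+-monoʳ-≤ ∥ f x ∥ (∥filter∥≤ f p xs))
... | false = m≤n⇒m≤1+n (≤-trans (∥filter∥≤ f p xs) (m≤n+m _ ∥ f x ∥))

filterᶠ : ∀ {Γ A} {xs : ∀ I → El Γ I → List (El A I)} {P : ∀ I → El (Γ ×ᵗ A) I → Set}
          {P? : ∀ I a → Dec (P I a)} →
          FP Γ (list A) xs → FP (Γ ×ᵗ A) bool (λ I a → does (P? I a)) →
          FP Γ (list A) (λ I γ → filter (λ x → P? I (γ , x)) (xs I γ))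
filterᶠ {Γ} {A} {xs} {P} {P?} XS B = ext (λ {I} γ → eq γ (xs I γ))
  (foldrᶠ XS nilᶠ (ifᶠ (B ∘ᶠ fstᶠ) (v₁ ∷ᶠ v₀) v₀) X
    (λ {I} γ xs → ≤-trans (∥filter∥≤ (enc A) (λ x → does (P? I (γ , x))) xs)
                          (m≤n⇒m≤1+n (m≤n+m _ ∥ enc Γ γ ∥))))
  where
  eq : ∀ {I} γ xs → foldr (λ x acc → if does (P? I (γ , x)) then x ∷ acc else acc) [] xs ≡
                    filter (λ x → P? I (γ , x)) xs
  eq γ [] = refl
  eq {I} γ (x ∷ xs) with does (P? I (γ , x))
  ... | true  = cong (x ∷_) (eq γ xs)
  ... | false = eq γ xs

-- A number is coded like a list of units, so list recursion also provides iteration over numbers.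
unary : ∀ n → encodeList (λ (_ : ⊤) → nil) (replicate n tt) ≡ encodeℕ n
unary zero    = refl
unary (suc n) = cong (nil ∙_) (unary n)

unaryᶠ : ∀ {Γ m} → FP Γ nat m → FP Γ (list unit) (λ I γ → replicate (m I γ) tt)
unaryᶠ {m = m} M = recodeʳ (λ {I} γ → sym (unary (m I γ))) M

predᶠ : FP nat nat (λ _ → pred)
predᶠ = record
  { code = case (var zero) nil (var (suc zero)) ; time = λ _ → 3
  ; runs = λ { zero → caseNil (var zero) nil ; (suc n) → caseCons (var zero) (var (suc zero)) }
  ; timeBound = con 3 ; time≤ = λ _ → ≤-refl
  ; sizeBound = X ; size≤ = λ { zero → ≤-refl ; (suc n) → m≤n⇒m≤1+n (m≤n+m _ 1) } }

nullᶠ : ∀ {Γ A xs} → FP Γ (list A) xs → FP Γ bool (λ I γ → null (xs I γ))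
nullᶠ {Γ} {A} {xs} XS = ext (λ {I} γ → eq (xs I γ))
  (foldrᶠ {s = λ _ _ → false} XS trueᶠ falseᶠ (con 3) (λ γ xs → encodeBool≤3 _))
  where
  eq : ∀ {B : Set} (xs : List B) → foldr (λ _ _ → false) true xs ≡ null xs
  eq []      = refl
  eq (_ ∷ _) = refl

monusᶠ : ∀ {Γ m n} → FP Γ nat m → FP Γ nat n → FP Γ nat (λ I γ → m I γ ∸ n I γ)
monusᶠ {Γ} {m} {n} M N = ext (λ {I} γ → foldr-pred (m I γ) (n I γ)) (difference ∘ᶠ (M ,ᶠ unaryᶠ N))
  where
  foldr-pred : ∀ m n → foldr (λ _ → pred) m (replicate n tt) ≡ m ∸ n
  foldr-pred m zero    = refl
  foldr-pred m (suc n) = trans (cong pred (foldr-pred m n)) (pred[m∸n]≡m∸[1+n] m n)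
  ∥pred∥≤ : ∀ n → ∥ encodeℕ (pred n) ∥ ≤ ∥ encodeℕ n ∥
  ∥pred∥≤ zero    = ≤-refl
  ∥pred∥≤ (suc n) = m≤n⇒m≤1+n (m≤n+m _ 1)
  bound : ∀ m (xs : List ⊤) → ∥ encodeℕ (foldr (λ _ → pred) m xs) ∥ ≤ ∥ encodeℕ m ∥
  bound m []       = ≤-refl
  bound m (_ ∷ xs) = ≤-trans (∥pred∥≤ (foldr (λ _ → pred) m xs)) (bound m xs)
  difference : FP (nat ×ᵗ list unit) nat (λ _ (m , xs) → foldr (λ _ → pred) m xs)
  difference = recᶠ idᶠ (predᶠ ∘ᶠ v₀) X (λ m xs → ≤-trans (bound m xs) (m≤n⇒m≤1+n (m≤m+n _ _)))

≤?ᶠ : ∀ {Γ m n} → FP Γ nat m → FP Γ nat n → FP Γ bool (λ I γ → does (m I γ ≤? n I γ))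
≤?ᶠ {m = m} {n} M N = ext (λ {I} γ → eq (m I γ) (n I γ)) (nullᶠ (unaryᶠ (monusᶠ M N)))
  where
  eq : ∀ m n → null (replicate (m ∸ n) tt) ≡ does (m ≤? n)
  eq zero    zero    = refl
  eq zero    (suc n) = refl
  eq (suc m) zero    = refl
  eq (suc m) (suc n) = trans (eq m n) (does-⇔ (mk⇔ s≤s s≤s⁻¹) (m ≤? n) (suc m ≤? suc n))

∥encodeℕ∥ : ∀ n → ∥ encodeℕ n ∥ ≡ 1 + (n + n)
∥encodeℕ∥ zero    = refl
∥encodeℕ∥ (suc n) = cong (2 +_) (trans (∥encodeℕ∥ n) (sym (+-suc n n)))

lengthᶠ : ∀ {Γ A xs} → FP Γ (list A) xs → FP Γ nat (λ I γ → length (xs I γ))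
lengthᶠ {Γ} {A} {xs} XS = foldrᶠ {s = λ _ a → suc (proj₂ a)} XS zeroᶠ (sucᶠ v₀) (con 1 ⊕ (X ⊕ X)) bound
  where
  bound : ∀ {I} (γ : El Γ I) xs → ∥ encodeℕ (length xs) ∥ ≤
                                  eval (con 1 ⊕ (X ⊕ X)) ∥ enc (Γ ×ᵗ list A) {I} (γ , xs) ∥
  bound γ xs = ≤-trans (≤-reflexive (∥encodeℕ∥ (length xs))) (s≤s (+-mono-≤ len≤ len≤))
    where
    len≤ : length xs ≤ ∥ enc (Γ ×ᵗ list A) (γ , xs) ∥
    len≤ = ≤-trans (length≤∥∥ (enc A) xs) (m≤n⇒m≤1+n (m≤n+m _ ∥ enc Γ γ ∥))

toℕᶠ : FP node nat (λ _ → toℕ)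
toℕᶠ = recodeʳ (λ _ → refl) idᶠ

edgeᶠ : FP edge (nat ×ᵗ ((node ×ᵗ node) ×ᵗ bool)) (λ I e →
  toℕ (opposite e) , ((Algorithm.src I e , Algorithm.tgt I e) , lookup (Instance.tree I) e))
edgeᶠ = recodeʳ (λ _ → refl) idᶠ

srcᶠ : ∀ {Γ e} → FP Γ edge e → FP Γ node (λ I γ → Algorithm.src I (e I γ))
srcᶠ E = fstᶠ ∘ᶠ fstᶠ ∘ᶠ sndᶠ ∘ᶠ edgeᶠ ∘ᶠ E

tgtᶠ : ∀ {Γ e} → FP Γ edge e → FP Γ node (λ I γ → Algorithm.tgt I (e I γ))
tgtᶠ E = sndᶠ ∘ᶠ fstᶠ ∘ᶠ sndᶠ ∘ᶠ edgeᶠ ∘ᶠ E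

inTreeᶠ : ∀ {Γ e} → FP Γ edge e → FP Γ bool (λ I γ → does (e I γ ∈? Instance.tree I))
inTreeᶠ {e = e} E = ext (λ {I} γ → eq (e I γ) (Instance.tree I)) (sndᶠ ∘ᶠ sndᶠ ∘ᶠ edgeᶠ ∘ᶠ E)
  where
  eq : ∀ {n} x (p : Subset n) → lookup p x ≡ does (x ∈? p)
  eq zero    (inside  ∷ p) = refl
  eq zero    (outside ∷ p) = refl
  eq (suc x) (s ∷ p)       = eq x p

≡ⁿᶠ : ∀ {Γ x y} → FP Γ node x → FP Γ node y → FP Γ bool (λ I γ → does (x I γ ≟ y I γ))
≡ⁿᶠ {x = x} {y} F G = ext (λ {I} γ → eq (x I γ) (y I γ))
  (≤?ᶠ (toℕᶠ ∘ᶠ F) (toℕᶠ ∘ᶠ G) ∧ᶠ ≤?ᶠ (toℕᶠ ∘ᶠ G) (toℕᶠ ∘ᶠ F))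
  where
  eq : ∀ {n} (x y : Fin n) → does (toℕ x ≤? toℕ y) ∧ does (toℕ y ≤? toℕ x) ≡ does (x ≟ y)
  eq x y = does-⇔ (mk⇔ (λ (x≤y , y≤x) → toℕ-injective (≤-antisym x≤y y≤x))
                       (λ { refl → ≤-refl , ≤-refl }))
                  ((toℕ x ≤? toℕ y) ×-dec (toℕ y ≤? toℕ x)) (x ≟ y)

≡ᵉᶠ : ∀ {Γ e f} → FP Γ edge e → FP Γ edge f → FP Γ bool (λ I γ → does (e I γ ≟ f I γ))
≡ᵉᶠ {e = e} {f} F G = ext (λ {I} γ → eq (e I γ) (f I γ)) (≤?ᶠ (index F) (index G) ∧ᶠ ≤?ᶠ (index G) (index F))
  where
  index : ∀ {Γ e} → FP Γ edge e → FP Γ nat (λ I γ → toℕ (opposite (e I γ)))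
  index F = fstᶠ ∘ᶠ edgeᶠ ∘ᶠ F
  opposite-injective : ∀ {n} {x y : Fin n} → opposite x ≡ opposite y → x ≡ y
  opposite-injective {x = x} {y} eq =
    trans (sym (opposite-involutive x)) (trans (cong opposite eq) (opposite-involutive y))
  eq : ∀ {n} (x y : Fin n) → let i = toℕ (opposite x); j = toℕ (opposite y) in
       does (i ≤? j) ∧ does (j ≤? i) ≡ does (x ≟ y)
  eq x y = does-⇔ (mk⇔ (λ (i≤j , j≤i) → opposite-injective (toℕ-injective (≤-antisym i≤j j≤i)))
                       (λ { refl → ≤-refl , ≤-refl }))
                  ((toℕ (opposite x) ≤? toℕ (opposite y)) ×-dec (toℕ (opposite y) ≤? toℕ (opposite x)))
                  (x ≟ y)

listsᶠ : ∀ {Γ} → {{Ctx Γ}} →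
         FP Γ (list node ×ᵗ list edge) (λ I _ → Algorithm.allNodes I , Algorithm.allEdges I)
listsᶠ = recodeʳ (λ _ → refl) instᶠ

allNodesᶠ : ∀ {Γ} → {{Ctx Γ}} → FP Γ (list node) (λ I _ → Algorithm.allNodes I)
allNodesᶠ = fstᶠ ∘ᶠ listsᶠ

allEdgesᶠ : ∀ {Γ} → {{Ctx Γ}} → FP Γ (list edge) (λ I _ → Algorithm.allEdges I)
allEdgesᶠ = sndᶠ ∘ᶠ listsᶠ

-- The codes of these are parts of the code of the instance.
record Small (A : Ty) : Set where
  field small : ∀ {I} (x : El A I) → ∥ enc A x ∥ ≤ ∥ enc inst {I} tt ∥

open Small {{...}} public

∈⇒∥∥≤ : ∀ {A : Set} (f : A → D) {x xs} → x ∈ˡ xs → ∥ f x ∥ ≤ ∥ encodeList f xs ∥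
∈⇒∥∥≤ f (here refl) = m≤n⇒m≤1+n (m≤m+n _ _)
∈⇒∥∥≤ f {xs = y ∷ _} (there x∈) = m≤n⇒m≤1+n (≤-trans (∈⇒∥∥≤ f x∈) (m≤n+m _ ∥ f y ∥))

instance
  small-node : Small node
  small-node = record { small = λ {I} x →
    ≤-trans (∈⇒∥∥≤ (encodeNode I) (Algorithm.∈-allNodes I x)) (m≤n⇒m≤1+n (m≤m+n _ _)) }

  small-edge : Small edge
  small-edge = record { small = λ {I} e →
    ≤-trans (∈⇒∥∥≤ (encodeEdge I) (∈-allFin e))
            (m≤n⇒m≤1+n (m≤n+m _ ∥ encodeList (encodeNode I) (Algorithm.allNodes I) ∥)) }

∥encodeList∥≤ : ∀ {A : Set} (f : A → D) {m} → (∀ x → ∥ f x ∥ ≤ m) → ∀ xs →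
                ∥ encodeList f xs ∥ ≤ 1 + length xs * (1 + m)
∥encodeList∥≤ f ≤m []       = ≤-refl
∥encodeList∥≤ f {m} ≤m (x ∷ xs) = s≤s (begin
  ∥ f x ∥ + ∥ encodeList f xs ∥          ≤⟨ +-mono-≤ (≤m x) (∥encodeList∥≤ f ≤m xs) ⟩
  m + (1 + length xs * (1 + m))          ≡⟨ +-suc m _ ⟩
  suc m + length xs * (1 + m)            ∎)
  where open ≤-Reasoning

module _ {Γ A B} {{_ : Ctx Γ}} {{_ : Small B}} {xs : ∀ I → El Γ I → List (El A I)} {z s}
         (XS : FP Γ (list A) xs) (Z : FP Γ (list B) z) (S : FP (Γ ×ᵗ A ×ᵗ list B) (list B) s) (c : ℕ)
         (length≤ : ∀ {I} γ xs → length (foldr (λ x acc → s I ((γ , x) , acc)) (z I γ) xs) ≤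
                                 c * ∥ enc (Γ ×ᵗ list A) {I} (γ , xs) ∥) where

  -- For lists of nodes or edges a linear bound on the length is enough: no entry has a larger code
  -- than the instance, whose code is at most as large as that of the context.
  foldr-listᶠ : FP Γ (list B) (λ I γ → foldr (λ x acc → s I ((γ , x) , acc)) (z I γ) (xs I γ))
  foldr-listᶠ = foldrᶠ XS Z S (con 1 ⊕ (con c ⊗ X) ⊗ (con 1 ⊕ X)) λ {I} γ xs → ≤-trans
    (∥encodeList∥≤ (enc B) {∥ enc inst {I} tt ∥} small (foldr (λ x acc → s I ((γ , x) , acc)) (z I γ) xs))
    (s≤s (*-mono-≤ (length≤ γ xs) (s≤s (≤-trans (inst≤ γ) (m≤n⇒m≤1+n (m≤m+n _ _))))))

-- Programs for the approximation algorithm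

opaque
  unfolding Algorithm.joins?

  joins?ᶠ : ∀ {Γ e x y} → FP Γ edge e → FP Γ node x → FP Γ node y →
            FP Γ bool (λ I γ → does (Algorithm.joins? I (e I γ) (x I γ) (y I γ)))
  joins?ᶠ E F G = (≡ⁿᶠ (srcᶠ E) F ∧ᶠ ≡ⁿᶠ (tgtᶠ E) G) ∨ᶠ (≡ⁿᶠ (srcᶠ E) G ∧ᶠ ≡ⁿᶠ (tgtᶠ E) F)

∈ⁿ?ᶠ : ∀ {Γ x xs} → FP Γ node x → FP Γ (list node) xs →
       FP Γ bool (λ I γ → does (Algorithm._∈ⁿ?_ I (x I γ) (xs I γ)))
∈ⁿ?ᶠ F XS = anyᶠ XS (≡ⁿᶠ (F ∘ᶠ fstᶠ) v₀)

∈ᵉ?ᶠ : ∀ {Γ e es} → FP Γ edge e → FP Γ (list edge) es →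
       FP Γ bool (λ I γ → does (Algorithm._∈ᵉ?_ I (e I γ) (es I γ)))
∈ᵉ?ᶠ F ES = anyᶠ ES (≡ᵉᶠ (F ∘ᶠ fstᶠ) v₀)

expandᶠ : FP (inst ×ᵗ edge ×ᵗ list node) (list node) (λ I ((_ , e) , xs) → Algorithm.expand I e xs)
expandᶠ = filterᶠ allNodesᶠ
  (∈ⁿ?ᶠ v₀ v₁ ∨ᶠ
   anyᶠ allEdgesᶠ ((inTreeᶠ v₀ ∧ᶠ notᶠ (≡ᵉᶠ v₀ v₃)) ∧ᶠ anyᶠ v₂ (joins?ᶠ v₁ v₂ v₀)))

module _ (I : Instance) where
  open Algorithm I

  length-reach : ∀ e z fuel → length (reach e z fuel) ≤ length allNodes
  length-reach e z []         = length-filter (_≟ z) allNodes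
  length-reach e z (_ ∷ fuel) =
    length-filter (λ y → y ∈ⁿ? reach e z fuel ⊎-dec adjacent? e (reach e z fuel) y) allNodes

  length-allNodes≤ : length allNodes ≤ ∥ enc inst {I} tt ∥
  length-allNodes≤ = ≤-trans (length≤∥∥ (encodeNode I) allNodes) (m≤n⇒m≤1+n (m≤m+n _ _))

reachᶠ : FP (inst ×ᵗ edge ×ᵗ node) (list node)
         (λ I ((_ , e) , z) → Algorithm.reach I e z (Algorithm.allNodes I))
reachᶠ = foldr-listᶠ allNodesᶠ (filterᶠ allNodesᶠ (≡ⁿᶠ v₀ v₁)) (expandᶠ ∘ᶠ (instᶠ ,ᶠ v₃ ,ᶠ v₀)) 1
  λ {I} ((tt , e) , z) fuel → ≤-trans (length-reach I e z fuel) (≤-trans (length-allNodes≤ I)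
    (≤-trans (inst≤ {Γ = inst ×ᵗ edge ×ᵗ node} {{ctx-×}} {I} ((tt , e) , z))
             (≤-trans (m≤n⇒m≤1+n (m≤m+n _ _)) (≤-reflexive (sym (*-identityˡ _))))))

opaque
  unfolding Algorithm.walk?

  walk?ᶠ : FP (inst ×ᵗ edge ×ᵗ node ×ᵗ node) bool
           (λ I (((_ , e) , x) , y) → does (Algorithm.walk? I e x y))
  walk?ᶠ = ∈ⁿ?ᶠ v₁ (reachᶠ ∘ᶠ (instᶠ ,ᶠ v₂ ,ᶠ v₀))

opaque
  unfolding Algorithm.between?

  covers?ᶠ : FP (inst ×ᵗ edge ×ᵗ edge) bool (λ I ((_ , f) , e) → does (Algorithm.covers? I f e))
  covers?ᶠ = inTreeᶠ v₀ ∧ᶠ notᶠ (walk?ᶠ ∘ᶠ (instᶠ ,ᶠ v₀ ,ᶠ srcᶠ v₁ ,ᶠ tgtᶠ v₁))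

opaque
  unfolding Algorithm.visits?

  visits?ᶠ : FP (inst ×ᵗ edge ×ᵗ node) bool (λ I ((_ , f) , x) → does (Algorithm.visits? I f x))
  visits?ᶠ = anyᶠ allEdgesᶠ (covers?ᶠ ∘ᶠ (instᶠ ,ᶠ v₂ ,ᶠ v₀) ∧ᶠ (≡ⁿᶠ (srcᶠ v₀) v₁ ∨ᶠ ≡ⁿᶠ (tgtᶠ v₀) v₁))

opaque
  unfolding Algorithm.near?

  near?ᶠ : FP (inst ×ᵗ node ×ᵗ node) bool (λ I ((_ , x) , y) → does (Algorithm.near? I x y))
  near?ᶠ = ≡ⁿᶠ v₁ v₀ ∨ᶠ anyᶠ allEdgesᶠ (joins?ᶠ v₀ v₂ v₁)

opaque
  unfolding Algorithm.dominates?

  dominates?ᶠ : FP (inst ×ᵗ edge ×ᵗ node) bool (λ I ((_ , f) , x) → does (Algorithm.dominates? I f x))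
  dominates?ᶠ = anyᶠ allNodesᶠ (visits?ᶠ ∘ᶠ (instᶠ ,ᶠ v₂ ,ᶠ v₀) ∧ᶠ near?ᶠ ∘ᶠ (instᶠ ,ᶠ v₁ ,ᶠ v₀))

opaque
  unfolding Algorithm.meets?

  meets?ᶠ : FP (inst ×ᵗ edge ×ᵗ edge) bool (λ I ((_ , f) , g) → does (Algorithm.meets? I f g))
  meets?ᶠ = anyᶠ allNodesᶠ (visits?ᶠ ∘ᶠ (instᶠ ,ᶠ v₂ ,ᶠ v₀) ∧ᶠ visits?ᶠ ∘ᶠ (instᶠ ,ᶠ v₁ ,ᶠ v₀))

opaque
  unfolding Approximation.linked?

  linked?ᶠ : FP (inst ×ᵗ list edge ×ᵗ edge ×ᵗ edge ×ᵗ edge ×ᵗ edge) bool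
             (λ I (((((_ , A) , f) , g) , h) , r) → does (Approximation.linked? I A f g h r))
  linked?ᶠ = (anyᶠ v₄ (meets?ᶠ ∘ᶠ (instᶠ ,ᶠ v₀ ,ᶠ v₄)) ∧ᶠ meets?ᶠ ∘ᶠ (instᶠ ,ᶠ v₃ ,ᶠ v₂)) ∧ᶠ
             (meets?ᶠ ∘ᶠ (instᶠ ,ᶠ v₂ ,ᶠ v₁) ∧ᶠ (meets?ᶠ ∘ᶠ (instᶠ ,ᶠ v₁ ,ᶠ v₀) ∧ᶠ notᶠ (∈ᵉ?ᶠ v₀ v₄)))

linksᶠ : ∀ {Γ} → {{Ctx Γ}} → FP Γ (list edge) (λ I _ → Approximation.links I)
linksᶠ = filterᶠ allEdgesᶠ (notᶠ (inTreeᶠ v₀))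

length≤₁ : ∀ {Γ A I} (γ : El Γ I) (xs : List (El A I)) → length xs ≤ 1 * ∥ enc (Γ ×ᵗ list A) {I} (γ , xs) ∥
length≤₁ {Γ} {A} γ xs = ≤-trans (length≤∥∥ (enc A) xs)
  (≤-trans (m≤n⇒m≤1+n (m≤n+m _ ∥ enc Γ γ ∥)) (≤-reflexive (sym (*-identityˡ _))))

≤*∥∥ : ∀ {m} c x → m ≤ c → m ≤ c * ∥ x ∥
≤*∥∥ c x m≤c = ≤-trans m≤c (≤-trans (≤-reflexive (sym (*-identityʳ c))) (*-monoʳ-≤ c (∥∥-pos x)))

uncoveredᶠ : FP (inst ×ᵗ list edge) (list node) (λ I (_ , F) → Approximation.Dominating.uncovered I F)
uncoveredᶠ = foldr-listᶠ v₀ allNodesᶠ (filterᶠ v₀ (notᶠ (dominates?ᶠ ∘ᶠ (instᶠ ,ᶠ v₂ ,ᶠ v₀)))) 1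
  λ {I} (tt , F₀) F → ≤-trans (shrinks I F) (≤-trans (length-allNodes≤ I)
    (≤-trans (inst≤ {Γ = inst ×ᵗ list edge} {{ctx-×}} {I} (tt , F₀))
             (≤-trans (m≤n⇒m≤1+n (m≤m+n _ _)) (≤-reflexive (sym (*-identityˡ _))))))
  where
  shrinks : ∀ I F → length (Approximation.Dominating.uncovered I F) ≤ length (Algorithm.allNodes I)
  shrinks I []      = ≤-refl
  shrinks I (f ∷ F) = ≤-trans
    (length-filter (λ x → ¬? (Algorithm.dominates? I f x)) (Approximation.Dominating.uncovered I F)) (shrinks I F)

gainᶠ : FP (inst ×ᵗ list node ×ᵗ edge) nat (λ I ((_ , U) , f) → Approximation.Dominating.gain I U f)
gainᶠ = lengthᶠ (filterᶠ v₁ (dominates?ᶠ ∘ᶠ (instᶠ ,ᶠ v₁ ,ᶠ v₀)))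

usefulᶠ : FP (inst ×ᵗ list node) (list edge) (λ I (_ , U) → Approximation.Dominating.useful I U)
usefulᶠ = filterᶠ linksᶠ (anyᶠ v₁ (dominates?ᶠ ∘ᶠ (instᶠ ,ᶠ v₁ ,ᶠ v₀)))

length-best : ∀ {A : Set} (gain : A → ℕ) fs → length (best gain fs) ≤ 1
length-best gain fs with best-spec gain fs
... | inj₁ (_ , eq)     = subst (λ ys → length ys ≤ 1) (sym eq) z≤n
... | inj₂ (_ , eq , _) = subst (λ ys → length ys ≤ 1) (sym eq) ≤-refl

bestᶠ : FP (inst ×ᵗ list node) (list edge)
        (λ I (_ , U) → best (Approximation.Dominating.gain I U) (Approximation.Dominating.useful I U))
bestᶠ = foldr-listᶠ usefulᶠ nilᶠ
  (ifᶠ (anyᶠ v₀ (≤?ᶠ (gainᶠ ∘ᶠ (instᶠ ,ᶠ v₃ ,ᶠ v₂)) (gainᶠ ∘ᶠ (instᶠ ,ᶠ v₃ ,ᶠ v₀)))) v₀ (v₁ ∷ᶠ nilᶠ)) 1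
  λ {I} (tt , U) fs → ≤*∥∥ 1 (enc (inst ×ᵗ list node ×ᵗ list edge) {I} ((tt , U) , fs))
                             (length-best (Approximation.Dominating.gain I U) fs)

++ᶠ : ∀ {Γ A xs ys} → FP Γ (list A) xs → FP Γ (list A) ys → FP Γ (list A) (λ I γ → xs I γ ++ ys I γ)
++ᶠ {Γ} {A} {xs} {ys} XS YS = ext (λ {I} γ → eq (xs I γ) (ys I γ)) (append ∘ᶠ (YS ,ᶠ XS))
  where
  eq : ∀ {B : Set} (xs ys : List B) → foldr _∷_ ys xs ≡ xs ++ ys
  eq []       ys = refl
  eq (x ∷ xs) ys = cong (x ∷_) (eq xs ys)
  bound : ∀ {B : Set} (f : B → D) ys xs →
          ∥ encodeList f (foldr _∷_ ys xs) ∥ ≤ suc (∥ encodeList f ys ∥ + ∥ encodeList f xs ∥)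
  bound f ys []       = m≤n⇒m≤1+n (m≤m+n _ _)
  bound f ys (x ∷ xs) = s≤s (begin
    ∥ f x ∥ + ∥ encodeList f (foldr _∷_ ys xs) ∥
      ≤⟨ +-monoʳ-≤ ∥ f x ∥ (bound f ys xs) ⟩
    ∥ f x ∥ + suc (∥ encodeList f ys ∥ + ∥ encodeList f xs ∥)
      ≡⟨ +-suc ∥ f x ∥ _ ⟩
    suc (∥ f x ∥ + (∥ encodeList f ys ∥ + ∥ encodeList f xs ∥))
      ≡⟨ cong suc (x∙yz≈y∙xz +-commutativeSemigroup (∥ f x ∥) (∥ encodeList f ys ∥) _) ⟩
    suc (∥ encodeList f ys ∥ + (∥ f x ∥ + ∥ encodeList f xs ∥))
      ≡⟨ +-suc ∥ encodeList f ys ∥ _ ⟨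
    ∥ encodeList f ys ∥ + ∥ encodeList f (x ∷ xs) ∥
      ∎)
    where
    open ≤-Reasoning
  append : FP (list A ×ᵗ list A) (list A) (λ _ (ys , xs) → foldr _∷_ ys xs)
  append = recᶠ idᶠ (v₁ ∷ᶠ v₀) X (λ ys xs → bound (enc A) ys xs)

extendᶠ : FP (inst ×ᵗ list edge) (list edge) (λ I (_ , F) → Approximation.Dominating.extend I F)
extendᶠ = ++ᶠ (bestᶠ ∘ᶠ (instᶠ ,ᶠ uncoveredᶠ)) v₀

coverᶠ : FP inst (list edge) (λ I _ → Approximation.Dominating.cover I)
coverᶠ = foldr-listᶠ allNodesᶠ nilᶠ (extendᶠ ∘ᶠ (instᶠ ,ᶠ v₀)) 1
  λ {I} tt fuel → ≤-trans (grows I fuel) (length≤₁ {inst} {node} {I} tt fuel)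
  where
  grows : ∀ I fuel → length (foldr (λ _ F → Approximation.Dominating.extend I F) [] fuel) ≤ length fuel
  grows I []         = z≤n
  grows I (x ∷ fuel) = ≤-trans (≤-reflexive (length-++ (best (gain U) (useful U))))
                               (+-mono-≤ (length-best (gain U) (useful U)) (grows I fuel))
    where
    open Approximation.Dominating I
    U = uncovered (foldr (λ _ F → extend F) [] fuel)

length-search : ∀ {A B : Set} (g : A → List B) {c} → (∀ x → length (g x) ≤ c) →
                ∀ xs → length (search g xs) ≤ c
length-search g {c} g≤ xs with search-sat g (λ ys → length ys ≤ c) xs (λ {x} _ → inj₂ (g≤ x))
... | inj₁ eq = subst (λ ys → length ys ≤ c) (sym eq) z≤n
... | inj₂ le = le

-- A search returns one of the results of its body, so the same constant bounds its length. Keeping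
-- the bound with the program lets searches be nested.
Short : ℕ → (Γ B : Ty) → (∀ I → El Γ I → List (El B I)) → Set
Short c Γ B g = FP Γ (list B) g × (∀ I a → length (g I a) ≤ c)

searchᶠ : ∀ {Γ A B c} {{_ : Ctx Γ}} {{_ : Small B}} {xs : ∀ I → El Γ I → List (El A I)} {g} →
          FP Γ (list A) xs → Short c (Γ ×ᵗ A) B g → Short c Γ B (λ I γ → search (λ x → g I (γ , x)) (xs I γ))
searchᶠ {Γ} {A} {c = c} {xs = xs} {g = g} XS (G , g≤) =
  -- The body runs again after a successful test, which at most doubles its cost.
  foldr-listᶠ XS nilᶠ (ifᶠ (nullᶠ (G ∘ᶠ fstᶠ)) v₀ (G ∘ᶠ fstᶠ)) c
    (λ {I} γ xs → ≤*∥∥ c (enc (Γ ×ᵗ list A) {I} (γ , xs)) (short I γ xs)) ,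
  λ I γ → short I γ (xs I γ)
  where
  short : ∀ I γ xs → length (search (λ x → g I (γ , x)) xs) ≤ c
  short I γ = length-search (λ x → g I (γ , x)) (λ x → g≤ I (γ , x))

attachmentᶠ : FP (inst ×ᵗ list edge ×ᵗ list edge) (list edge)
  (λ I ((_ , R) , A) → Join.attachment (Algorithm._≟ᵉ_ I) (Approximation.linked? I) (Approximation.links I) R A)
attachmentᶠ = proj₁ (searchᶠ linksᶠ (searchᶠ linksᶠ (searchᶠ linksᶠ (searchᶠ (v₄ {inst}) chainᶠ))))
  where
  chainᶠ : Short 4 (inst ×ᵗ list edge ×ᵗ list edge ×ᵗ edge ×ᵗ edge ×ᵗ edge ×ᵗ edge) edge
    (λ I ((((((_ , R) , A) , f) , g) , h) , r) →
      if does (Approximation.linked? I A f g h r) then r ∷ h ∷ g ∷ f ∷ [] else [])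
  chainᶠ = ifᶠ (linked?ᶠ ∘ᶠ (instᶠ ,ᶠ v₄ ,ᶠ v₃ ,ᶠ v₂ ,ᶠ v₁ ,ᶠ v₀)) (v₀ ∷ᶠ v₁ ∷ᶠ v₂ ∷ᶠ v₃ ∷ᶠ nilᶠ) nilᶠ ,
           λ I ((((((_ , R) , A) , f) , g) , h) , r) → length≤4 (does (Approximation.linked? I A f g h r))
    where
    length≤4 : ∀ {B : Set} b {x y z w : B} → length (if b then x ∷ y ∷ z ∷ w ∷ [] else []) ≤ 4
    length≤4 true  = ≤-refl
    length≤4 false = z≤n

joinᶠ : FP (inst ×ᵗ list edge) (list edge)
  (λ I (_ , R) → Join.join (Algorithm._≟ᵉ_ I) (Approximation.linked? I) (Approximation.links I) R)
joinᶠ = foldr-listᶠ v₀ (proj₁ (searchᶠ v₀ ((v₀ ∷ᶠ nilᶠ) , λ _ _ → ≤-refl)))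
  (++ᶠ (attachmentᶠ ∘ᶠ (instᶠ ,ᶠ v₂ ,ᶠ v₀)) v₀) 5
  λ {I} (tt , R) xs → ≤-trans
    (Join.length-joinSteps (Algorithm._≟ᵉ_ I) (Approximation.linked? I) (Approximation.links I) R xs)
    (+-mono-≤ (∥∥-pos (enc (inst ×ᵗ list edge ×ᵗ list edge) {I} ((tt , R) , xs)))
              (*-monoʳ-≤ 4 (≤-trans (length≤∥∥ (enc edge {I}) xs)
                (m≤n⇒m≤1+n (m≤n+m _ (∥ enc (inst ×ᵗ list edge) {I} (tt , R) ∥))))))

-- Output of the solution, preprocessing of the input, and the whole program.

encodeList-tabulate : ∀ {A B : Set} {n} (f : A → D) (g : B → D) {h : Fin n → A} {k : Fin n → B} →
  (∀ i → f (h i) ≡ g (k i)) → encodeList f (List.tabulate h) ≡ encodeList g (List.tabulate k)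
encodeList-tabulate {n = zero}  f g eq = refl
encodeList-tabulate {n = suc n} f g eq = cong₂ _∙_ (eq zero) (encodeList-tabulate f g (eq ∘ suc))

solutionᶠ : FP inst (list bool) (λ I _ → toList (Approximation.solution I))
solutionᶠ = ext (λ {I} _ → eq id (λ e → does (Algorithm._∈ᵉ?_ I e (Approximation.Connecting.join I))))
  (members ∘ᶠ ((instᶠ ,ᶠ joinᶠ ∘ᶠ (idᶠ ,ᶠ coverᶠ)) ,ᶠ allEdgesᶠ))
  where
  eq : ∀ {A : Set} {n} (f : Fin n → A) (p : A → Bool) →
       foldr (λ x acc → p x ∷ acc) [] (List.tabulate f) ≡ toList (Vec.tabulate (p ∘ f))
  eq {n = zero}  f p = refl
  eq {n = suc n} f p = cong (p (f zero) ∷_) (eq (f ∘ suc) p)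
  length≡ : ∀ {A : Set} (p : A → Bool) xs → length (foldr (λ x acc → p x ∷ acc) [] xs) ≡ length xs
  length≡ p []       = refl
  length≡ p (x ∷ xs) = cong suc (length≡ p xs)
  members : FP (inst ×ᵗ list edge ×ᵗ list edge) (list bool)
    (λ I ((_ , A) , es) → foldr (λ e acc → does (Algorithm._∈ᵉ?_ I e A) ∷ acc) [] es)
  members = recᶠ nilᶠ (∈ᵉ?ᶠ v₁ v₂ ∷ᶠ v₀) (con 1 ⊕ X ⊗ con 4) λ {I} (tt , A) es →
    let p = λ e → does (Algorithm._∈ᵉ?_ I e A) in
    ≤-trans (∥encodeList∥≤ encodeBool encodeBool≤3 (foldr (λ e acc → p e ∷ acc) [] es))
      (s≤s (*-monoˡ-≤ 4 (≤-trans (≤-reflexive (length≡ p es)) (≤-trans (length≤∥∥ (enc edge {I}) es)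
        (m≤n⇒m≤1+n (m≤n+m _ (∥ enc (inst ×ᵗ list edge) {I} (tt , A) ∥)))))))

-- Maps over a list in which each element is numbered from the end.

module _ {A B} {h : ∀ I → El (nat ×ᵗ A) I → El B I} (H : FP (nat ×ᵗ A) B h) where

  private
    number : ∀ I → List (El A I) → List (El B I)
    number I = foldr (λ x acc → h I (length acc , x) ∷ acc) []

    length-number : ∀ I xs → length (number I xs) ≡ length xs
    length-number I []       = refl
    length-number I (x ∷ xs) = cong suc (length-number I xs)

    itemBound : Polynomial
    itemBound = con 1 ⊕ (sizeBound H ⟨ con 1 ⊕ ((con 1 ⊕ (X ⊕ X)) ⊕ X) ⟩)

    ∥number∥≤ : ∀ I n xs → ∥ enc (list A) {I} xs ∥ ≤ n →
                ∥ enc (list B) {I} (number I xs) ∥ ≤ 1 + length xs * eval itemBound n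
    ∥number∥≤ I n []       ≤n = ≤-refl
    ∥number∥≤ I n (x ∷ xs) ≤n = s≤s (begin
      ∥ enc B (h I (length (number I xs) , x)) ∥ + ∥ enc (list B) {I} (number I xs) ∥
        ≤⟨ +-mono-≤ item (∥number∥≤ I n xs (≤-trans (m≤n⇒m≤1+n (m≤n+m _ _)) ≤n)) ⟩
      itemSize + (1 + length xs * suc itemSize)  ≡⟨ +-suc itemSize _ ⟩
      suc itemSize + length xs * suc itemSize    ∎)
      where
      open ≤-Reasoning
      itemSize : ℕ
      itemSize = eval (sizeBound H ⟨ con 1 ⊕ ((con 1 ⊕ (X ⊕ X)) ⊕ X) ⟩) n
      len≤ : length (number I xs) ≤ n
      len≤ = ≤-trans (≤-reflexive (length-number I xs)) (≤-trans (length≤∥∥ (enc A) xs)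
               (≤-trans (m≤n⇒m≤1+n (m≤n+m _ (∥ enc A x ∥))) ≤n))
      item : ∥ enc B (h I (length (number I xs) , x)) ∥ ≤ itemSize
      item = ≤-trans (size≤ H {I} (length (number I xs) , x))
        (eval-≤⟨⟩ (sizeBound H) (con 1 ⊕ ((con 1 ⊕ (X ⊕ X)) ⊕ X)) n
          (s≤s (+-mono-≤ (≤-trans (≤-reflexive (∥encodeℕ∥ (length (number I xs)))) (s≤s (+-mono-≤ len≤ len≤)))
                         (≤-trans (m≤n⇒m≤1+n (m≤m+n _ _)) ≤n))))

  numberᶠ : ∀ {Γ xs} → FP Γ (list A) xs →
            FP Γ (list B) (λ I γ → foldr (λ x acc → h I (length acc , x) ∷ acc) [] (xs I γ))
  numberᶠ {Γ} XS = foldrᶠ XS nilᶠ (H ∘ᶠ (lengthᶠ v₀ ,ᶠ v₁) ∷ᶠ v₀) (con 1 ⊕ X ⊗ itemBound)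
    λ {I} γ xs →
      let s≤ : ∥ enc (list A) {I} xs ∥ ≤ ∥ enc (Γ ×ᵗ list A) {I} (γ , xs) ∥
          s≤ = m≤n⇒m≤1+n (m≤n+m _ (∥ enc Γ {I} γ ∥)) in
      ≤-trans (∥number∥≤ I (∥ enc (Γ ×ᵗ list A) {I} (γ , xs) ∥) xs s≤)
        (s≤s (*-monoˡ-≤ (eval itemBound (∥ enc (Γ ×ᵗ list A) {I} (γ , xs) ∥)) (≤-trans (length≤∥∥ (enc A) xs) s≤)))

-- When position `i` is reached, the accumulator has one entry for each later position, hence
-- `toℕ (opposite i)` entries.
number-tabulate : ∀ {A B : Set} (h : ℕ × A → B) {n} (v : Vec A n) →
  foldr (λ x acc → h (length acc , x) ∷ acc) [] (toList v) ≡
  List.tabulate (λ i → h (toℕ (opposite i) , lookup v i))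
number-tabulate h []      = refl
number-tabulate h {suc n} (x ∷ v) rewrite number-tabulate h v = cong₂ (λ k → h (k , x) ∷_)
  (trans (length-tabulate (λ i → h (toℕ (opposite i) , lookup v i))) (sym (toℕ-fromℕ n)))
  (tabulate-cong λ i → cong (λ k → h (k , lookup v i)) (sym (opposite-suc i)))

rawᶠ : FP raw (nat ×ᵗ list ((node ×ᵗ node) ×ᵗ bool))
       (λ I _ → Instance.order I , toList (zip (Instance.ends I) (Instance.tree I)))
rawᶠ = recodeʳ (λ _ → refl) idᶠ

-- Numbering the unary code of `order` yields the descending list of nodes. Numbering the input's
-- edge list attaches to each entry the number that serves as the name of the edge.
preprocessᶠ : FP raw inst (λ _ _ → tt)
preprocessᶠ = recodeʳ (λ {I} _ → cong₂ _∙_ (nodesEq I) (edgesEq I))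
  (numberᶠ {unit} (fstᶠ {nat}) (unaryᶠ (fstᶠ ∘ᶠ rawᶠ)) ,ᶠ
   numberᶠ {(node ×ᵗ node) ×ᵗ bool} (idᶠ {nat ×ᵗ ((node ×ᵗ node) ×ᵗ bool)}) (sndᶠ ∘ᶠ rawᶠ))
  where
  nodesEq : ∀ I → encodeList encodeℕ
                    (foldr (λ _ acc → length acc ∷ acc) [] (replicate (Instance.order I) tt)) ≡
                  encodeList (encodeNode I) (Algorithm.allNodes I)
  nodesEq I = trans
    (cong (encodeList encodeℕ) (trans
      (cong (foldr (λ _ acc → length acc ∷ acc) []) (sym (toList-replicate (Instance.order I) tt)))
      (number-tabulate proj₁ (Vec.replicate (Instance.order I) tt))))
    (encodeList-tabulate encodeℕ (encodeNode I) {h = toℕ ∘ opposite} {k = opposite} (λ _ → refl))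
  edgesEq : ∀ I → encodeList (enc (nat ×ᵗ ((node ×ᵗ node) ×ᵗ bool)) {I})
                    (foldr (λ x acc → (length acc , x) ∷ acc) []
                           (toList (zip (Instance.ends I) (Instance.tree I)))) ≡
                  encodeList (encodeEdge I) (Algorithm.allEdges I)
  edgesEq I = trans
    (cong (encodeList (enc (nat ×ᵗ ((node ×ᵗ node) ×ᵗ bool)) {I}))
          (number-tabulate id (zip (Instance.ends I) (Instance.tree I))))
    (encodeList-tabulate (enc (nat ×ᵗ ((node ×ᵗ node) ×ᵗ bool)) {I}) (encodeEdge I)
      λ e → cong (λ x → encodeℕ (toℕ (opposite e)) ∙ enc ((node ×ᵗ node) ×ᵗ bool) {I} x)
                 (lookup-zip e (Instance.ends I) (Instance.tree I)))

mainᶠ : FP raw (list bool) (λ I _ → toList (Approximation.solution I))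
mainᶠ = solutionᶠ ∘ᶠ preprocessᶠ

polynomialTime : ∀ {B f} (F : FP raw B f) → PolynomialTimeOn encodeInstance (code F)
polynomialTime {B} {f} F with eval≤monomial (timeBound F)
... | c , d , ≤cd = c , d , λ I → enc B (f I tt) , time F {I} tt , runs F tt ,
  ≤-trans (time≤ F tt) (≤cd ∥ encodeInstance I ∥ {{>-nonZero (∥∥-pos (encodeInstance I))}})

theorem2 : ∃[ p ] PolynomialTimeOn encodeInstance p × ∃[ C ] ∀ (I : Instance) → let open Instance I in
    ∃ Feasible → ∃[ F ] Outputs p (encodeInstance I) (encodeSubset F) × Feasible F ×
    (∀ k → IsMinimumSize k → ∣ F ∣ ≤ (C * ⌊log₂ order ⌋) * k)
theorem2 = code mainᶠ , polynomialTime mainᶠ , 10 , λ I (_ , feasible) →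
  Approximation.solution I , (time mainᶠ {I} tt , runs mainᶠ tt) ,
  Approximation.solution-feasible I feasible ,
  λ { k ((F , F-feasible , refl) , _) → Approximation.solution-size I F-feasible }
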